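{- If $\sigma$ and $\rho$ are non-crossing partitions and $\sigma$ is connected, then $\sigma[\rho]$ and $\rho[\sigma]$ are cc-equivalent.
   Context: Set partitions are written in canonical sequential form (restricted growth words). A partition is non-crossing if it avoids the pattern $1212$ (pattern containment = having a subsequence order-isomorphic to the pattern). For partitions $\alpha,\beta$, $\alpha[\beta]$ is the concatenation of $\alpha$ with $\beta+r$, $r$ the number of blocks of $\alpha$. A partition $\pi$ is connected if it cannot be written as $\alpha[\beta]$ with $\alpha,\beta$ nonempty; every partition is uniquely $\pi=\sigma_1[\sigma_2]\cdots[\sigma_m]$ with nonempty connected $\sigma_i$, its components. Two non-crossing patterns $\sigma,\tau$ are cc-equivalent if there is a bijection from the set of partitions avoiding both $1212$ and $\sigma$ to the set of partitions avoiding both $1212$ and $\tau$ that preserves size and number of components. -}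

module Defs where

open import Data.Fin.Base using (cast)
open import Data.List.Base using (List; []; _∷_; _++_; map; foldr; length; lookup)
open import Data.List.Relation.Binary.Sublist.Propositional using (_⊆_)
open import Data.List.Relation.Unary.All using (All)
open import Data.Nat.Base using (ℕ; suc; _+_; _⊔_; _≤_; _<_; z≤n; s≤s)
open import Data.Nat.Properties
  using (+-identityʳ; +-suc; +-monoʳ-≤; +-distribˡ-⊔; ⊔-assoc; ⊔-identityʳ; m≤n⇒m≤o+n; ≤-irrelevant)
open import Data.Product.Base using (Σ; ∃; ∃₂; _×_; _,_)
open import Data.Refinement using (Refinement-syntax; value)
open import Function.Bundles using (_⇔_; _⤖_; Bijection)
open import Relation.Binary.PropositionalEquality using (_≡_; _≢_; refl; sym; cong; subst)
open import Relation.Nullary.Negation.Core using (¬_)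

-- `RestrictedGrowth r w`: w is a valid continuation of a canonical sequence
-- in which exactly the letters 1, …, r have occurred.
data RestrictedGrowth (r : ℕ) : List ℕ → Set where
  []   : RestrictedGrowth r []
  cons : ∀ {x xs} → 1 ≤ x → x ≤ suc r →
         RestrictedGrowth (r ⊔ x) xs → RestrictedGrowth r (x ∷ xs)

-- A set partition in canonical sequential form: the i-th letter is the index of
-- the block containing i, blocks being numbered 1, 2, … by increasing minima.
record Partition : Set where
  constructor partition
  field
    word    : List ℕ
    isCanon : RestrictedGrowth 0 word

open Partition public

growth-irrelevant : ∀ {r w} (p q : RestrictedGrowth r w) → p ≡ q
growth-irrelevant [] [] = refl
growth-irrelevant (cons a b g) (cons a′ b′ g′)
  rewrite ≤-irrelevant a a′ | ≤-irrelevant b b′ | growth-irrelevant g g′ = refl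

word-injective : ∀ {π σ} → word π ≡ word σ → π ≡ σ
word-injective {partition w p} {partition .w q} refl = cong (partition w) (growth-irrelevant p q)

size : Partition → ℕ
size π = length (word π)

maxLetter : List ℕ → ℕ
maxLetter = foldr _⊔_ 0

-- The letters of a canonical sequence are exactly 1, …, r, with r the number of blocks.
blocks : Partition → ℕ
blocks π = maxLetter (word π)

NonEmpty : Partition → Set
NonEmpty π = word π ≢ []

∅ : Partition
∅ = partition [] []

shift-growth : ∀ s {r w} → RestrictedGrowth r w → RestrictedGrowth (s + r) (map (s +_) w)
shift-growth s [] = []
shift-growth s {r} (cons {x} {xs} 1≤x x≤1+r g) =
  cons (m≤n⇒m≤o+n s 1≤x)
       (subst (s + x ≤_) (+-suc s r) (+-monoʳ-≤ s x≤1+r))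
       (subst (λ k → RestrictedGrowth k (map (s +_) xs)) (+-distribˡ-⊔ s r x) (shift-growth s g))

++-growth : ∀ {r v w} → RestrictedGrowth r v → RestrictedGrowth (r ⊔ maxLetter v) w →
            RestrictedGrowth r (v ++ w)
++-growth {r} {w = w} [] h = subst (λ k → RestrictedGrowth k w) (⊔-identityʳ r) h
++-growth {r} {w = w} (cons {x} {xs} 1≤x x≤1+r g) h =
  cons 1≤x x≤1+r
    (++-growth g (subst (λ k → RestrictedGrowth k w) (sym (⊔-assoc r x (maxLetter xs))) h))

infixl 6 _[_]

_[_] : Partition → Partition → Partition
word    (α [ β ]) = word α ++ map (blocks α +_) (word β)
isCanon (α [ β ]) = ++-growth (isCanon α)
  (subst (λ k → RestrictedGrowth k (map (blocks α +_) (word β)))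
         (+-identityʳ (blocks α)) (shift-growth (blocks α) (isCanon β)))

OrderIsomorphic : List ℕ → List ℕ → Set
OrderIsomorphic u v = Σ (length u ≡ length v) λ eq →
  ∀ i j → lookup u i < lookup u j ⇔ lookup v (cast eq i) < lookup v (cast eq j)

_Contains_ : Partition → Partition → Set
π Contains σ = ∃ λ u → u ⊆ word π × OrderIsomorphic u (word σ)

_Avoids_ : Partition → Partition → Set
π Avoids σ = ¬ (π Contains σ)

p1212 : Partition
word    p1212 = 1 ∷ 2 ∷ 1 ∷ 2 ∷ []
isCanon p1212 = cons (s≤s z≤n) (s≤s z≤n) (cons (s≤s z≤n) (s≤s (s≤s z≤n))
               (cons (s≤s z≤n) (s≤s z≤n) (cons (s≤s z≤n) (s≤s (s≤s z≤n)) [])))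

NonCrossing : Partition → Set
NonCrossing π = π Avoids p1212

Connected : Partition → Set
Connected π = ¬ (∃₂ λ α β → NonEmpty α × NonEmpty β × π ≡ α [ β ])

-- Since α [ β [ γ ] ] = α [ β ] [ γ ], the right-nested fold is σ₁ [ σ₂ ] ⋯ [ σₘ ].
ComponentsOf : Partition → List Partition → Set
ComponentsOf π σs = All (λ σ → NonEmpty σ × Connected σ) σs × π ≡ foldr _[_] ∅ σs

-- Every partition has a unique list of components, so this relation is
-- the graph of the function "number of components".
HasComponentCount : Partition → ℕ → Set
HasComponentCount π m = ∃ λ σs → ComponentsOf π σs × length σs ≡ m

-- In the refinement type the proof of avoidance is irrelevant, so that
-- elements are equal as soon as the underlying partitions are.
NonCrossingAvoiders : Partition → Set
NonCrossingAvoiders σ = [ π ∈ Partition ∣ NonCrossing π × π Avoids σ ]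

CCEquivalent : Partition → Partition → Set
CCEquivalent σ τ =
  Σ (NonCrossingAvoiders σ ⤖ NonCrossingAvoiders τ) λ f →
    ∀ π → let π′ = Bijection.to f π in
      size (value π′) ≡ size (value π) ×
      (∀ m → HasComponentCount (value π) m ⇔ HasComponentCount (value π′) m)

{-# OPTIONS --safe #-}
-- Non-crossing partitions are rose forests: size, blocks and components are the numbers of
-- nodes, leaves and trees. Let K be a minimal subtree containing σ, and call P and D the
-- forests that stand left and right of the path from the roots to K. Since σ is connected,
-- there is exactly one K with P avoiding σ (if σ occurs at all), and for it the whole avoids
-- σ[ρ] iff D avoids ρ; likewise there is exactly one K with D avoiding σ, and for it the
-- whole avoids ρ[σ] iff P avoids ρ. The bijection keeps K and exchanges P with D, redistributing
-- their trees along the path so that the left and right counts are swapped at every level.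
module Submission where

open import Defs
open import Data.Empty using (⊥-elim)
open import Data.Fin.Base using (zero; suc; cast)
open import Data.Fin.Properties using (all?)
open import Data.List.Base using (List; []; _∷_; _++_; map; foldr; length; lookup; take; drop)
open import Data.List.Membership.Propositional using (_∈_)
open import Data.List.Membership.Propositional.Properties using (∈-++⁺ˡ; ∈-++⁺ʳ; ∈-++⁻; ∈-map⁺; ∈-map⁻)
open import Data.List.Properties
open import Data.List.Relation.Binary.Sublist.Propositional
  using (_⊆_; []; _∷ʳ_; _∷_; ⊆-refl; ⊆-trans; ⊆-reflexive; minimum; from∈)
open import Data.List.Relation.Binary.Sublist.Propositional.Properties
  using (++⁺; ++⁺ˡ; ++⁺ʳ; map⁺; All-resp-⊆)
open import Data.List.Relation.Unary.All as All using (All; []; _∷_)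
import Data.List.Relation.Unary.All.Properties as Allₚ
open import Data.List.Relation.Unary.Any using (here; there)
open import Data.Nat.Base
open import Data.Nat.Properties
open import Data.Nat.Tactic.RingSolver using (solve-∀)
open import Data.Product.Base as Product using (∃; ∃₂; _×_; _,_; proj₁; proj₂)
open import Data.Sum.Base as Sum using (_⊎_; inj₁; inj₂)
open import Function.Base using (_∘_; id)
open import Data.Refinement using (value; value-injective; _,_)
import Data.Irrelevant as Irr
open import Function.Bundles using (_⇔_; _⤖_; mk⇔; mk↔ₛ′; Equivalence)
open import Function.Construct.Identity using (⤖-id)
open import Function.Properties.Inverse using (↔⇒⤖)
open import Function.Properties.Equivalence using () renaming (sym to ⇔-sym; trans to ⇔-trans)
open import Relation.Binary.PropositionalEquality hiding ([_])
open import Relation.Nullary.Decidable.Core using (Dec; yes; no; map′; _×-dec_; _→-dec_)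
open import Relation.Nullary.Recomputable using (¬-recompute)
open import Relation.Nullary.Negation.Core using (¬_; contradiction)

-- Connectedness enters through one fact (`Unsplittable`): if all letters of a lie below those of b,
-- a copy of σ in a ++ b lies in a or in b. Words of successive trees are related in this way, so a
-- copy of σ in a forest lies in a single tree, and descending always into the first (or last) tree
-- with such a copy leads to K. The letter of an inner node stands last in the word of its subtree
-- and is minimal there. Hence it takes no part in a copy of σ[ρ] or ρ[σ] inside that subtree when
-- both factors are nonempty. The path nodes are thus invisible to the patterns, and only the lists
-- P and D and the tree K matter. Exchanging the two sibling lists at each level would not do: left
-- siblings are read on the way down the path and right siblings on the way up, so the order of the
-- levels would be reversed, while ρ may spread over several trees and its avoidance depends on
-- their order. Therefore only the counts are exchanged per level, and P and D are dealt out anew in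
-- their own order. Every path node keeps its degree; the number of components is the degree of a
-- virtual root above the forest.

infix 4 _≪_

-- The relation between the two factors of a copy of α[β]: `occurs-[]` and `matching-concat`
-- translate such copies into pairs u ≪ v and back.
_≪_ : List ℕ → List ℕ → Set
u ≪ v = All (λ x → All (x <_) v) u

≪-resp-⊆ : ∀ {u u′ v v′} → u′ ⊆ u → v′ ⊆ v → u ≪ v → u′ ≪ v′
≪-resp-⊆ s t = All.map (All-resp-⊆ t) ∘ All-resp-⊆ s

≪-between : ∀ {m u v} → All (_≤ m) u → All (m <_) v → u ≪ v
≪-between u≤m m<v = All.map (λ x≤m → All.map (≤-<-trans x≤m) m<v) u≤m

-- Subsequences and factorizations of lists

module _ {A : Set} where

  ⊆-++⁻ : ∀ a {b u : List A} → u ⊆ a ++ b →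
          ∃₂ λ u₁ u₂ → u ≡ u₁ ++ u₂ × u₁ ⊆ a × u₂ ⊆ b
  ⊆-++⁻ [] s = [] , _ , refl , [] , s
  ⊆-++⁻ (x ∷ a) (_ ∷ʳ s) =
    let u₁ , u₂ , eq , s₁ , s₂ = ⊆-++⁻ a s in u₁ , u₂ , eq , x ∷ʳ s₁ , s₂
  ⊆-++⁻ (x ∷ a) (refl ∷ s) =
    let u₁ , u₂ , eq , s₁ , s₂ = ⊆-++⁻ a s in x ∷ u₁ , u₂ , cong (x ∷_) eq , refl ∷ s₁ , s₂

  -- Levi's lemma for the free monoid.
  ++-≡-++ : ∀ (u x : List A) {v y} → u ++ v ≡ x ++ y →
            (∃ λ m → x ≡ u ++ m × v ≡ m ++ y) ⊎ (∃ λ m → u ≡ x ++ m × y ≡ m ++ v)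
  ++-≡-++ [] x eq = inj₁ (x , refl , eq)
  ++-≡-++ (a ∷ u) [] eq = inj₂ (a ∷ u , refl , sym eq)
  ++-≡-++ (a ∷ u) (b ∷ x) eq with refl , eq′ ← ∷-injective eq with ++-≡-++ u x eq′
  ... | inj₁ (m , p , q) = inj₁ (m , cong (a ∷_) p , q)
  ... | inj₂ (m , p , q) = inj₂ (m , cong (a ∷_) p , q)

  ++-⊆-++⁻ : ∀ u {v} a {b : List A} → u ++ v ⊆ a ++ b →
             (∃₂ λ v₁ v₂ → v ≡ v₁ ++ v₂ × u ++ v₁ ⊆ a × v₂ ⊆ b) ⊎
             (∃₂ λ u₁ u₂ → u ≡ u₁ ++ u₂ × u₁ ⊆ a × u₂ ++ v ⊆ b)
  ++-⊆-++⁻ u a s with x , y , eq , s₁ , s₂ ← ⊆-++⁻ a s with ++-≡-++ u x eq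
  ... | inj₁ (m , refl , p) = inj₁ (m , y , p , s₁ , s₂)
  ... | inj₂ (m , p , refl) = inj₂ (x , m , p , s₁ , s₂)

  ⊆-∷ʳ⁻ : ∀ {x} w {u : List A} → u ⊆ w ++ x ∷ [] → u ⊆ w ⊎ ∃ λ u′ → u ≡ u′ ++ x ∷ []
  ⊆-∷ʳ⁻ w s with ⊆-++⁻ w s
  ... | u₁ , _ , refl , s₁ , (_ ∷ʳ []) = inj₁ (subst (_⊆ w) (sym (++-identityʳ u₁)) s₁)
  ... | u₁ , _ , refl , s₁ , (refl ∷ []) = inj₂ (u₁ , refl)

  ++-≡-∷ʳ : ∀ (u v : List A) {w x} → u ++ v ≡ w ++ x ∷ [] → v ≡ [] ⊎ x ∈ v
  ++-≡-∷ʳ u v {w} eq with ++-≡-++ u w eq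
  ... | inj₁ (m , _ , refl) = inj₂ (∈-++⁺ʳ m (here refl))
  ... | inj₂ ([] , _ , refl) = inj₂ (here refl)
  ... | inj₂ (_ ∷ m , _ , q) = inj₁ (++-conicalʳ m v (sym (∷-injectiveʳ q)))

  -- Compares two marked positions in one list. It serves twice: to decode a word into trees, and to
  -- compare two paths that branch at siblings.
  ++-∷-trichotomy : ∀ L L′ {t t′} {R R′ : List A} → L ++ t ∷ R ≡ L′ ++ t′ ∷ R′ →
    (L ≡ L′ × t ≡ t′ × R ≡ R′) ⊎ (t ∈ L′ × t′ ∈ R) ⊎ (t′ ∈ L × t ∈ R′)
  ++-∷-trichotomy [] [] refl = inj₁ (refl , refl , refl)
  ++-∷-trichotomy [] (_ ∷ L′) refl = inj₂ (inj₁ (here refl , ∈-++⁺ʳ L′ (here refl)))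
  ++-∷-trichotomy (_ ∷ L) [] refl = inj₂ (inj₂ (here refl , ∈-++⁺ʳ L (here refl)))
  ++-∷-trichotomy (x ∷ L) (y ∷ L′) eq with refl , eq′ ← ∷-injective eq with ++-∷-trichotomy L L′ eq′
  ... | inj₁ (p , q) = inj₁ (cong (x ∷_) p , q)
  ... | inj₂ (inj₁ (p , q)) = inj₂ (inj₁ (there p , q))
  ... | inj₂ (inj₂ (p , q)) = inj₂ (inj₂ (there p , q))

  -- The predicate has to vary in the induction: once x is kept, the rest is searched for P ∘ (x
  -- ∷_). The search for K branches on this decision.
  ⊆-dec : ∀ {P : List A → Set} → (∀ u → Dec (P u)) → ∀ w → Dec (∃ λ u → u ⊆ w × P u)
  ⊆-dec P? [] = map′ (λ p → [] , [] , p) (λ { (_ , [] , p) → p }) (P? [])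
  ⊆-dec P? (x ∷ w) with ⊆-dec P? w | ⊆-dec (P? ∘ (x ∷_)) w
  ... | yes (u , s , p) | _ = yes (u , x ∷ʳ s , p)
  ... | no _ | yes (u , s , p) = yes (x ∷ u , refl ∷ s , p)
  ... | no ¬p | no ¬q = no λ
    { (u , (_ ∷ʳ s) , p) → ¬p (u , s , p)
    ; (_ , (refl ∷ s) , p) → ¬q (_ , s , p) }

-- Order isomorphism

OrderPreserving : List (ℕ × ℕ) → Set
OrderPreserving ws = ∀ {p q} → p ∈ ws → q ∈ ws → proj₁ p < proj₁ q ⇔ proj₂ p < proj₂ q

-- Order isomorphism as a list of pairs: it can be cut, concatenated and mapped without the index
-- casts of `OrderIsomorphic`.
record Matching (u v : List ℕ) : Set where
  constructor matching
  field
    pairs : List (ℕ × ℕ)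
    fst≡ : map proj₁ pairs ≡ u
    snd≡ : map proj₂ pairs ≡ v
    preserving : OrderPreserving pairs

zipped : ∀ u v → (eq : length u ≡ length v) →
         ∃ λ (ws : List (ℕ × ℕ)) → map proj₁ ws ≡ u × map proj₂ ws ≡ v ×
         (∀ {p} → p ∈ ws → ∃ λ i → lookup u i ≡ proj₁ p × lookup v (cast eq i) ≡ proj₂ p)
zipped [] [] _ = [] , refl , refl , λ ()
zipped (x ∷ u) (y ∷ v) eq with zipped u v (cong pred eq)
... | ws , p , q , f = (x , y) ∷ ws , cong (x ∷_) p , cong (y ∷_) q , λ
  { (here refl) → zero , refl , refl
  ; (there m) → let i , a , b = f m in suc i , a , b }

order⇒matching : ∀ {u v} → OrderIsomorphic u v → Matching u v
order⇒matching {u} {v} (eq , f) with zipped u v eq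
... | ws , p , q , g = matching ws p q λ m m′ →
  let i , a , b = g m ; j , c , d = g m′ in transport a c b d (f i j)
  where
  transport : ∀ {a a′ b b′ c c′ d d′ : ℕ} → a ≡ a′ → b ≡ b′ → c ≡ c′ → d ≡ d′ →
         a < b ⇔ c < d → a′ < b′ ⇔ c′ < d′
  transport refl refl refl refl e = e

lookup-pair : ∀ (ws : List (ℕ × ℕ)) .(eq : length (map proj₁ ws) ≡ length (map proj₂ ws)) i →
              (lookup (map proj₁ ws) i , lookup (map proj₂ ws) (cast eq i)) ∈ ws
lookup-pair (_ ∷ ws) eq zero = here refl
lookup-pair (_ ∷ ws) eq (suc i) = there (lookup-pair ws (cong pred eq) i)

matching⇒order : ∀ {u v} → Matching u v → OrderIsomorphic u v
matching⇒order (matching ws refl refl f) =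
  eq , λ i j → f (lookup-pair ws eq i) (lookup-pair ws eq j)
  where eq = trans (length-map proj₁ ws) (sym (length-map proj₂ ws))

matching? : ∀ v u → Dec (Matching u v)
matching? v u with length u ≟ length v
... | no ≢ = no λ m → ≢ (proj₁ (matching⇒order m))
... | yes eq = map′ (λ f → order⇒matching (eq , f)) (λ m → proj₂ (matching⇒order m))
  (all? λ i → all? λ j → map′ (λ (f , g) → mk⇔ f g) (λ e → Equivalence.to e , Equivalence.from e)
    ((_ <? _ →-dec _ <? _) ×-dec (_ <? _ →-dec _ <? _)))

matching-sym : ∀ {u v} → Matching u v → Matching v u
matching-sym (matching ws refl refl f) = matching (map Product.swap ws)
  (sym (map-∘ ws)) (sym (map-∘ ws)) λ m m′ →
  case (∈-map⁻ Product.swap m) (∈-map⁻ Product.swap m′)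
  where
  case : ∀ {p q} → (∃ λ x → x ∈ ws × p ≡ Product.swap x) → (∃ λ x → x ∈ ws × q ≡ Product.swap x) →
         proj₁ p < proj₁ q ⇔ proj₂ p < proj₂ q
  case (_ , m , refl) (_ , m′ , refl) = ⇔-sym (f m m′)

matching-map : ∀ {u v} (f : ℕ → ℕ) → (∀ {x y} → x ∈ v → y ∈ v → x < y ⇔ f x < f y) →
               Matching u v → Matching u (map f v)
matching-map f mono (matching ws refl refl g) = matching (map (Product.map₂ f) ws)
  (sym (map-∘ ws)) (trans (sym (map-∘ ws)) (map-∘ ws)) λ m m′ →
  case (∈-map⁻ _ m) (∈-map⁻ _ m′)
  where
  case : ∀ {p q} → (∃ λ x → x ∈ ws × p ≡ Product.map₂ f x) →
         (∃ λ x → x ∈ ws × q ≡ Product.map₂ f x) →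
         proj₁ p < proj₁ q ⇔ proj₂ p < proj₂ q
  case (_ , m , refl) (_ , m′ , refl) = ⇔-trans (g m m′) (mono (∈-map⁺ proj₂ m) (∈-map⁺ proj₂ m′))

matching-shift : ∀ s {u v} → Matching u v → Matching u (map (s +_) v)
matching-shift s = matching-map (s +_) λ _ _ → mk⇔ (+-monoʳ-< s) (+-cancelˡ-< s _ _)

map-unshift : ∀ s v → map (_∸ s) (map (s +_) v) ≡ v
map-unshift s v = trans (sym (map-∘ v)) (trans (map-cong (m+n∸m≡n s) v) (map-id v))

matching-unshift : ∀ s {u v} → Matching u (map (s +_) v) → Matching u v
matching-unshift s {u} {v} m =
  subst (Matching u) (map-unshift s v) (matching-map (_∸ s) mono m)
  where
  mono : ∀ {x y} → x ∈ map (s +_) v → y ∈ map (s +_) v → x < y ⇔ x ∸ s < y ∸ s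
  mono x∈ y∈ with a , _ , refl ← ∈-map⁻ _ x∈ | b , _ , refl ← ∈-map⁻ _ y∈
    rewrite m+n∸m≡n s a | m+n∸m≡n s b = mk⇔ (+-cancelˡ-< s _ _) (+-monoʳ-< s)

map-≡-++ : ∀ {A B : Set} (f : A → B) ws a {b} → map f ws ≡ a ++ b →
           ∃₂ λ ws₁ ws₂ → ws ≡ ws₁ ++ ws₂ × map f ws₁ ≡ a × map f ws₂ ≡ b
map-≡-++ f ws [] eq = [] , ws , refl , refl , eq
map-≡-++ f (w ∷ ws) (x ∷ a) eq with refl , eq′ ← ∷-injective eq
  with ws₁ , ws₂ , refl , refl , q ← map-≡-++ f ws a eq′ = w ∷ ws₁ , ws₂ , refl , refl , q

matching-++⁻ : ∀ {u} a {b} → Matching u (a ++ b) →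
               ∃₂ λ u₁ u₂ → u ≡ u₁ ++ u₂ × Matching u₁ a × Matching u₂ b × (a ≪ b → u₁ ≪ u₂)
matching-++⁻ a (matching ws refl eq f) with ws₁ , ws₂ , refl , refl , refl ← map-≡-++ proj₂ ws a eq =
  map proj₁ ws₁ , map proj₁ ws₂ , map-++ proj₁ ws₁ ws₂ ,
  matching ws₁ refl refl (λ m m′ → f (∈-++⁺ˡ m) (∈-++⁺ˡ m′)) ,
  matching ws₂ refl refl (λ m m′ → f (∈-++⁺ʳ ws₁ m) (∈-++⁺ʳ ws₁ m′)) ,
  λ a≪b → Allₚ.map⁺ (All.tabulate λ m → Allₚ.map⁺ (All.tabulate λ m′ →
    Equivalence.from (f (∈-++⁺ˡ m) (∈-++⁺ʳ ws₁ m′))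
      (All.lookup (All.lookup a≪b (∈-map⁺ proj₂ m)) (∈-map⁺ proj₂ m′))))

matching-++⁺ : ∀ {u v a b} → u ≪ v → a ≪ b → Matching u a → Matching v b → Matching (u ++ v) (a ++ b)
matching-++⁺ u≪v a≪b (matching ws refl refl f) (matching ws′ refl refl g) =
  matching (ws ++ ws′) (map-++ proj₁ ws ws′) (map-++ proj₂ ws ws′) λ m m′ →
  case (∈-++⁻ ws m) (∈-++⁻ ws m′)
  where
  below : ∀ {p q} (h : ℕ × ℕ → ℕ) → map h ws ≪ map h ws′ → p ∈ ws → q ∈ ws′ → h p < h q
  below h lt m m′ = All.lookup (All.lookup lt (∈-map⁺ h m)) (∈-map⁺ h m′)
  case : ∀ {p q} → p ∈ ws ⊎ p ∈ ws′ → q ∈ ws ⊎ q ∈ ws′ → proj₁ p < proj₁ q ⇔ proj₂ p < proj₂ q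
  case (inj₁ m) (inj₁ m′) = f m m′
  case (inj₂ m) (inj₂ m′) = g m m′
  case (inj₁ m) (inj₂ m′) = mk⇔ (λ _ → below proj₂ a≪b m m′) (λ _ → below proj₁ u≪v m m′)
  case (inj₂ m) (inj₁ m′) = mk⇔ (λ l → contradiction l (<-asym (below proj₁ u≪v m′ m)))
                                (λ l → contradiction l (<-asym (below proj₂ a≪b m′ m)))

matching-[] : ∀ {u} → Matching u [] → u ≡ []
matching-[] (matching [] refl _ _) = refl

-- Occurrences of patterns in arbitrary words

Occurs : List ℕ → List ℕ → Set
Occurs p w = ∃ λ u → u ⊆ w × Matching u p

occurs? : ∀ p w → Dec (Occurs p w)
occurs? p = ⊆-dec (matching? p)

occurs-⊆ : ∀ {p w w′} → w ⊆ w′ → Occurs p w → Occurs p w′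
occurs-⊆ s (u , t , m) = u , ⊆-trans t s , m

⊆-map⁻ : ∀ (f : ℕ → ℕ) w {u} → u ⊆ map f w → ∃ λ u′ → u ≡ map f u′ × u′ ⊆ w
⊆-map⁻ f [] [] = [] , refl , []
⊆-map⁻ f (x ∷ w) (_ ∷ʳ s) = Product.map₂ (Product.map₂ (x ∷ʳ_)) (⊆-map⁻ f w s)
⊆-map⁻ f (x ∷ w) (refl ∷ s) with u , refl , t ← ⊆-map⁻ f w s = x ∷ u , refl , refl ∷ t

occurs-shift⁺ : ∀ s {p w} → Occurs p w → Occurs p (map (s +_) w)
occurs-shift⁺ s (u , t , m) = _ , map⁺ (s +_) t , matching-sym (matching-shift s (matching-sym m))

occurs-shift⁻ : ∀ s {p w} → Occurs p (map (s +_) w) → Occurs p w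
occurs-shift⁻ s {w = w} (_ , t , m) with u , refl , t′ ← ⊆-map⁻ (s +_) w t =
  u , t′ , matching-sym (matching-unshift s (matching-sym m))

contains⇒occurs : ∀ {π σ} → π Contains σ → Occurs (word σ) (word π)
contains⇒occurs (u , s , o) = u , s , order⇒matching o

occurs⇒contains : ∀ {π σ} → Occurs (word σ) (word π) → π Contains σ
occurs⇒contains (u , s , m) = u , s , matching⇒order m

-- Connectedness of words

-- Connectedness in a form that makes sense for words that are not canonical, and so passes to every
-- copy of σ inside a larger word.
Unsplittable : List ℕ → Set
Unsplittable u = ∀ {u₁ u₂} → u ≡ u₁ ++ u₂ → u₁ ≪ u₂ → u₁ ≡ [] ⊎ u₂ ≡ []

unsplittable-matching : ∀ {u p} → Unsplittable p → Matching u p → Unsplittable u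
unsplittable-matching unsp m {u₁} refl u₁≪u₂ with matching-++⁻ u₁ (matching-sym m)
... | p₁ , p₂ , eq , m₁ , m₂ , f with unsp eq (f u₁≪u₂)
... | inj₁ refl = inj₁ (matching-[] (matching-sym m₁))
... | inj₂ refl = inj₂ (matching-[] (matching-sym m₂))

-- If the border between a and b cut u properly, the two pieces would inherit a ≪ b and split u. So
-- the border falls inside v or at an end of u.
unsplittable-++-⊆ : ∀ {u v} a {b} → Unsplittable u → a ≪ b → u ++ v ⊆ a ++ b →
  (∃₂ λ v₁ v₂ → v ≡ v₁ ++ v₂ × u ++ v₁ ⊆ a × v₂ ⊆ b) ⊎ u ++ v ⊆ b
unsplittable-++-⊆ {u} {v} a unsp a≪b s with ++-⊆-++⁻ u a s
... | inj₁ r = inj₁ r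
... | inj₂ (u₁ , u₂ , refl , s₁ , s₂)
  with unsp refl (≪-resp-⊆ s₁ (⊆-trans (++⁺ʳ v ⊆-refl) s₂) a≪b)
... | inj₁ refl = inj₂ s₂
... | inj₂ refl = inj₁ ([] , v , refl ,
  subst (_⊆ a) (sym (trans (++-identityʳ _) (++-identityʳ u₁))) s₁ , s₂)

++-unsplittable-⊆ : ∀ v {u} a {b} → Unsplittable u → a ≪ b → v ++ u ⊆ a ++ b →
  v ++ u ⊆ a ⊎ (∃₂ λ v₁ v₂ → v ≡ v₁ ++ v₂ × v₁ ⊆ a × v₂ ++ u ⊆ b)
++-unsplittable-⊆ v a unsp a≪b s with ++-⊆-++⁻ v a s
... | inj₂ r = inj₂ r
... | inj₁ (u₁ , u₂ , refl , s₁ , s₂)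
  with unsp refl (≪-resp-⊆ (⊆-trans (++⁺ˡ v ⊆-refl) s₁) s₂ a≪b)
... | inj₁ refl = inj₂ (v , [] , sym (++-identityʳ v) , subst (_⊆ a) (++-identityʳ v) s₁ , s₂)
... | inj₂ refl = inj₁ (subst (λ x → v ++ x ⊆ a) (sym (++-identityʳ u₁)) s₁)

occurs-++⁻ : ∀ {p} a {b} → Unsplittable p → a ≪ b → Occurs p (a ++ b) → Occurs p a ⊎ Occurs p b
occurs-++⁻ a unsp a≪b (u , s , m) with ++-unsplittable-⊆ [] a (unsplittable-matching unsp m) a≪b s
... | inj₁ t = inj₁ (u , t , m)
... | inj₂ ([] , [] , _ , _ , t) = inj₂ (u , t , m)

growth-++⁻ˡ : ∀ {r} v {w} → RestrictedGrowth r (v ++ w) → RestrictedGrowth r v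
growth-++⁻ˡ [] _ = []
growth-++⁻ˡ (x ∷ v) (cons a b g) = cons a b (growth-++⁻ˡ v g)

growth-++⁻ʳ : ∀ {r} v {w} → RestrictedGrowth r (v ++ w) → RestrictedGrowth (r ⊔ maxLetter v) w
growth-++⁻ʳ {r} [] g = subst (λ k → RestrictedGrowth k _) (sym (⊔-identityʳ r)) g
growth-++⁻ʳ {r} (x ∷ v) (cons a b g) =
  subst (λ k → RestrictedGrowth k _) (⊔-assoc r x (maxLetter v)) (growth-++⁻ʳ v g)

growth-positive : ∀ {r w} → RestrictedGrowth r w → All (0 <_) w
growth-positive [] = []
growth-positive (cons a _ g) = a ∷ growth-positive g

unshift-growth : ∀ s {r w} → All (s <_) w → RestrictedGrowth (s + r) w →
                 RestrictedGrowth r (map (_∸ s) w)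
unshift-growth s [] [] = []
unshift-growth s {r} (s<x ∷ s<w) (cons {x} a b g) = cons (m<n⇒0<n∸m s<x)
  (m≤n+o⇒m∸n≤o x s (subst (x ≤_) (sym (+-suc s r)) b))
  (unshift-growth s s<w (subst (λ k → RestrictedGrowth k _)
    (sym (trans (+-distribˡ-⊔ s r (x ∸ s)) (cong (s + r ⊔_) (m+[n∸m]≡n (<⇒≤ s<x))))) g))

map-shift-unshift : ∀ s {w} → All (s <_) w → w ≡ map (s +_) (map (_∸ s) w)
map-shift-unshift s [] = refl
map-shift-unshift s (s<x ∷ s<w) = cong₂ _∷_ (sym (m+[n∸m]≡n (<⇒≤ s<x))) (map-shift-unshift s s<w)

maxLetter-< : ∀ {w y} → 0 < y → All (_< y) w → maxLetter w < y
maxLetter-< 0<y [] = 0<y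
maxLetter-< 0<y (x<y ∷ w<y) = ⊔-lub x<y (maxLetter-< 0<y w<y)

≤-maxLetter : ∀ w → All (_≤ maxLetter w) w
≤-maxLetter [] = []
≤-maxLetter (x ∷ w) = m≤m⊔n x _ ∷ All.map (λ le → ≤-trans le (m≤n⊔m x _)) (≤-maxLetter w)

≪-column : ∀ {u y v} → u ≪ (y ∷ v) → All (_< y) u
≪-column = All.map λ { (x<y ∷ _) → x<y }

maxLetter-≪ : ∀ {u v} → All (0 <_) v → u ≪ v → All (maxLetter u <_) v
maxLetter-≪ [] _ = []
maxLetter-≪ (0<y ∷ 0<v) u≪v = maxLetter-< 0<y (≪-column u≪v) ∷
  maxLetter-≪ 0<v (All.map (λ { (_ ∷ ps) → ps }) u≪v)

-- If u₁ ≪ u₂ cuts a canonical word, all of u₂ exceeds the maximum of u₁. Subtracting that maximum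
-- makes u₂ canonical, and the cut becomes a decomposition α[β].
connected⇒unsplittable : ∀ {σ} → Connected σ → Unsplittable (word σ)
connected⇒unsplittable conn {[]} _ _ = inj₁ refl
connected⇒unsplittable conn {_ ∷ _} {[]} _ _ = inj₂ refl
connected⇒unsplittable {partition _ g} conn {u₁@(_ ∷ _)} {u₂@(_ ∷ _)} refl u₁≪u₂ =
  ⊥-elim (conn (α , β , (λ ()) , (λ ()) ,
    word-injective (cong (u₁ ++_) (map-shift-unshift (maxLetter u₁) above))))
  where
  g₂ = growth-++⁻ʳ u₁ g
  above = maxLetter-≪ (growth-positive g₂) u₁≪u₂
  α = partition u₁ (growth-++⁻ˡ u₁ g)
  β = partition (map (_∸ maxLetter u₁) u₂)
        (unshift-growth (maxLetter u₁) above
          (subst (λ k → RestrictedGrowth k u₂) (sym (+-identityʳ (maxLetter u₁))) g₂))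

-- Rose forests and their canonical words

data Tree : Set where
  node : List Tree → Tree

Forest : Set
Forest = List Tree

leavesᵗ : Tree → ℕ
leavesᶠ : Forest → ℕ
leavesᵗ (node []) = 1
leavesᵗ (node (T ∷ F)) = leavesᵗ T + leavesᶠ F
leavesᶠ [] = 0
leavesᶠ (T ∷ F) = leavesᵗ T + leavesᶠ F

nodesᵗ : Tree → ℕ
nodesᶠ : Forest → ℕ
nodesᵗ (node F) = suc (nodesᶠ F)
nodesᶠ [] = 0
nodesᶠ (T ∷ F) = nodesᵗ T + nodesᶠ F

-- Postorder, each node labelled by the number (counted from n + 1) of its leftmost leaf:
-- a leaf opens a new block, and an inner node repeats the letter of its first child.
wordᵗ : ℕ → Tree → List ℕ
wordᶠ : ℕ → Forest → List ℕ
wordᵗ n (node F) = wordᶠ n F ++ suc n ∷ []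
wordᶠ n [] = []
wordᶠ n (T ∷ F) = wordᵗ n T ++ wordᶠ (n + leavesᵗ T) F

leavesᵗ-positive : ∀ T → 1 ≤ leavesᵗ T
leavesᵗ-positive (node []) = ≤-refl
leavesᵗ-positive (node (T ∷ F)) = m≤n⇒m≤n+o (leavesᶠ F) (leavesᵗ-positive T)

leavesᶠ-++ : ∀ F G → leavesᶠ (F ++ G) ≡ leavesᶠ F + leavesᶠ G
leavesᶠ-++ [] G = refl
leavesᶠ-++ (T ∷ F) G = trans (cong (leavesᵗ T +_) (leavesᶠ-++ F G)) (sym (+-assoc (leavesᵗ T) _ _))

nodesᶠ-++ : ∀ F G → nodesᶠ (F ++ G) ≡ nodesᶠ F + nodesᶠ G
nodesᶠ-++ [] G = refl
nodesᶠ-++ (T ∷ F) G = trans (cong (nodesᵗ T +_) (nodesᶠ-++ F G)) (sym (+-assoc (nodesᵗ T) _ _))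

length-wordᵗ : ∀ n T → length (wordᵗ n T) ≡ nodesᵗ T
length-wordᶠ : ∀ n F → length (wordᶠ n F) ≡ nodesᶠ F
length-wordᵗ n (node F) =
  trans (length-++ (wordᶠ n F)) (trans (+-comm _ 1) (cong suc (length-wordᶠ n F)))
length-wordᶠ n [] = refl
length-wordᶠ n (T ∷ F) =
  trans (length-++ (wordᵗ n T)) (cong₂ _+_ (length-wordᵗ n T) (length-wordᶠ _ F))

wordᶠ-++ : ∀ n F G → wordᶠ n (F ++ G) ≡ wordᶠ n F ++ wordᶠ (n + leavesᶠ F) G
wordᶠ-++ n [] G = cong (λ k → wordᶠ k G) (sym (+-identityʳ n))
wordᶠ-++ n (T ∷ F) G = trans (cong (wordᵗ n T ++_) (trans (wordᶠ-++ (n + leavesᵗ T) F G)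
    (cong (λ k → wordᶠ (n + leavesᵗ T) F ++ wordᶠ k G) (+-assoc n _ _))))
  (sym (++-assoc (wordᵗ n T) _ _))

wordᵗ-shift : ∀ m n T → wordᵗ (m + n) T ≡ map (m +_) (wordᵗ n T)
wordᶠ-shift : ∀ m n F → wordᶠ (m + n) F ≡ map (m +_) (wordᶠ n F)
wordᵗ-shift m n (node F) = trans (cong₂ (λ w x → w ++ x ∷ []) (wordᶠ-shift m n F) (sym (+-suc m n)))
  (sym (map-++ (m +_) (wordᶠ n F) _))
wordᶠ-shift m n [] = refl
wordᶠ-shift m n (T ∷ F) = trans (cong₂ _++_ (wordᵗ-shift m n T)
    (trans (cong (λ k → wordᶠ k F) (+-assoc m n _)) (wordᶠ-shift m _ F)))
  (sym (map-++ (m +_) (wordᵗ n T) _))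

wordᵗ-above : ∀ n T → All (n <_) (wordᵗ n T)
wordᶠ-above : ∀ n F → All (n <_) (wordᶠ n F)
wordᵗ-above n (node F) = Allₚ.++⁺ (wordᶠ-above n F) (≤-refl ∷ [])
wordᶠ-above n [] = []
wordᶠ-above n (T ∷ F) =
  Allₚ.++⁺ (wordᵗ-above n T) (All.map (≤-<-trans (m≤m+n n _)) (wordᶠ-above _ F))

wordᵗ-below : ∀ n T → All (_≤ n + leavesᵗ T) (wordᵗ n T)
wordᶠ-below : ∀ n F → All (_≤ n + leavesᶠ F) (wordᶠ n F)
wordᵗ-below n (node []) = ≤-reflexive (+-comm 1 n) ∷ []
wordᵗ-below n T@(node F@(_ ∷ _)) = Allₚ.++⁺ (wordᶠ-below n F)
  (≤-trans (≤-reflexive (+-comm 1 n)) (+-monoʳ-≤ n (leavesᵗ-positive T)) ∷ [])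
wordᶠ-below n [] = []
wordᶠ-below n (T ∷ F) = Allₚ.++⁺
  (All.map (λ le → ≤-trans le (+-monoʳ-≤ n (m≤m+n _ _))) (wordᵗ-below n T))
  (All.map (λ le → ≤-trans le (≤-reflexive (+-assoc n _ _))) (wordᶠ-below _ F))

wordᵗ-≪-wordᶠ : ∀ n T F → wordᵗ n T ≪ wordᶠ (n + leavesᵗ T) F
wordᵗ-≪-wordᶠ n T F = ≪-between (wordᵗ-below n T) (wordᶠ-above _ F)

wordᶠ-≪-wordᶠ : ∀ n F G → wordᶠ n F ≪ wordᶠ (n + leavesᶠ F) G
wordᶠ-≪-wordᶠ n F G = ≪-between (wordᶠ-below n F) (wordᶠ-above _ G)

⊔-repeat : ∀ n T → (n + leavesᵗ T) ⊔ suc n ≡ n + leavesᵗ T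
⊔-repeat n T = m≥n⇒m⊔n≡m (≤-trans (≤-reflexive (+-comm 1 n)) (+-monoʳ-≤ n (leavesᵗ-positive T)))

⊔-fresh : ∀ n → n ⊔ suc n ≡ n + 1
⊔-fresh n = trans (m≤n⇒m⊔n≡n (n≤1+n n)) (+-comm 1 n)

-- Restricted growth is read from left to right, so a tree is checked together with an arbitrary
-- continuation w, which starts after n + `leavesᵗ` T letters have been introduced.
growthᵗ : ∀ n T {w} → RestrictedGrowth (n + leavesᵗ T) w → RestrictedGrowth n (wordᵗ n T ++ w)
growthᶠ : ∀ n F {w} → RestrictedGrowth (n + leavesᶠ F) w → RestrictedGrowth n (wordᶠ n F ++ w)
growthᵗ n (node []) {w} g =
  cons (s≤s z≤n) ≤-refl (subst (λ k → RestrictedGrowth k w) (sym (⊔-fresh n)) g)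
growthᵗ n T@(node F@(_ ∷ _)) {w} g =
  subst (RestrictedGrowth n) (sym (++-assoc (wordᶠ n F) (suc n ∷ []) w))
    (growthᶠ n F (cons (s≤s z≤n) (s≤s (m≤m+n n _))
      (subst (λ k → RestrictedGrowth k w) (sym (⊔-repeat n T)) g)))
growthᶠ n [] {w} g = subst (λ k → RestrictedGrowth k w) (+-identityʳ n) g
growthᶠ n (T ∷ F) {w} g = subst (RestrictedGrowth n) (sym (++-assoc (wordᵗ n T) _ w))
  (growthᵗ n T (growthᶠ _ F (subst (λ k → RestrictedGrowth k w) (sym (+-assoc n _ _)) g)))

fromForest : Forest → Partition
fromForest F = partition (wordᶠ 0 F)
  (subst (RestrictedGrowth 0) (++-identityʳ (wordᶠ 0 F)) (growthᶠ 0 F []))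

maxLetter-++ : ∀ u v → maxLetter (u ++ v) ≡ maxLetter u ⊔ maxLetter v
maxLetter-++ [] v = refl
maxLetter-++ (x ∷ u) v = trans (cong (x ⊔_) (maxLetter-++ u v)) (sym (⊔-assoc x _ _))

-- The maximum with n accounts for the empty forest, whose word has no letter to witness the shift.
maxLetterᵗ : ∀ n T → n ⊔ maxLetter (wordᵗ n T) ≡ n + leavesᵗ T
maxLetterᶠ : ∀ n F → n ⊔ maxLetter (wordᶠ n F) ≡ n + leavesᶠ F
maxLetterᵗ n (node []) = trans (cong (n ⊔_) (⊔-identityʳ (suc n))) (⊔-fresh n)
maxLetterᵗ n T@(node F@(_ ∷ _)) = begin
  n ⊔ maxLetter (wordᶠ n F ++ suc n ∷ [])    ≡⟨ cong (n ⊔_) (maxLetter-++ (wordᶠ n F) _) ⟩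
  n ⊔ (maxLetter (wordᶠ n F) ⊔ (suc n ⊔ 0))  ≡⟨ ⊔-assoc n _ _ ⟨
  (n ⊔ maxLetter (wordᶠ n F)) ⊔ (suc n ⊔ 0)  ≡⟨ cong₂ _⊔_ (maxLetterᶠ n F) (⊔-identityʳ (suc n)) ⟩
  (n + leavesᵗ T) ⊔ suc n                    ≡⟨ ⊔-repeat n T ⟩
  n + leavesᵗ T                              ∎
  where open ≡-Reasoning
maxLetterᶠ n [] = trans (⊔-identityʳ n) (sym (+-identityʳ n))
maxLetterᶠ n (T ∷ F) = begin
  n ⊔ maxLetter (wordᵗ n T ++ w)             ≡⟨ cong (n ⊔_) (maxLetter-++ (wordᵗ n T) w) ⟩
  n ⊔ (maxLetter (wordᵗ n T) ⊔ maxLetter w)  ≡⟨ ⊔-assoc n _ _ ⟨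
  (n ⊔ maxLetter (wordᵗ n T)) ⊔ maxLetter w  ≡⟨ cong (_⊔ maxLetter w) (maxLetterᵗ n T) ⟩
  (n + leavesᵗ T) ⊔ maxLetter w              ≡⟨ maxLetterᶠ _ F ⟩
  n + leavesᵗ T + leavesᶠ F                  ≡⟨ +-assoc n _ _ ⟩
  n + (leavesᵗ T + leavesᶠ F)                ∎
  where
  open ≡-Reasoning
  w = wordᶠ (n + leavesᵗ T) F

fromForest-++ : ∀ F G → fromForest (F ++ G) ≡ fromForest F [ fromForest G ]
fromForest-++ F G = word-injective (trans (wordᶠ-++ 0 F G) (cong (wordᶠ 0 F ++_)
  (trans (cong (λ k → wordᶠ k G) (trans (sym (maxLetterᶠ 0 F)) (sym (+-identityʳ _))))
         (wordᶠ-shift (blocks (fromForest F)) 0 G))))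

-- Non-crossing partitions are forests

1212-unsplittable : Unsplittable (word p1212)
1212-unsplittable {[]} _ _ = inj₁ refl
1212-unsplittable {_ ∷ []} refl ((_ ∷ s≤s () ∷ _) ∷ _)
1212-unsplittable {_ ∷ _ ∷ []} refl (_ ∷ (s≤s () ∷ _) ∷ _)
1212-unsplittable {_ ∷ _ ∷ _ ∷ []} refl (_ ∷ (s≤s (s≤s ()) ∷ _) ∷ _)
1212-unsplittable {_ ∷ _ ∷ _ ∷ _ ∷ _} {[]} _ _ = inj₂ refl
1212-unsplittable {_ ∷ _ ∷ _ ∷ _ ∷ []} {_ ∷ _} ()
1212-unsplittable {_ ∷ _ ∷ _ ∷ _ ∷ _ ∷ _} {_ ∷ _} ()

-- The last letter of a 1212 exceeds the first, so it cannot be the least letter available. This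
-- rules out the root of a tree, whose letter is minimal and stands last.
1212-last : ∀ {n u v} → Matching u (word p1212) → All (n <_) u → u ≢ v ++ suc n ∷ []
1212-last {v = v} m n<u eq with matching⇒order m
1212-last {u = a ∷ b ∷ c ∷ d ∷ []} {v} m (n<a ∷ _) eq | _ , f
  with refl ← ∷ʳ-injectiveʳ (a ∷ b ∷ c ∷ []) v eq =
  <⇒≱ (Equivalence.from (f zero (suc (suc (suc zero)))) ≤-refl) n<a

noncrossingᵗ : ∀ n T → ¬ Occurs (word p1212) (wordᵗ n T)
noncrossingᶠ : ∀ n F → ¬ Occurs (word p1212) (wordᶠ n F)
noncrossingᵗ n T@(node F) (u , s , m) with ⊆-∷ʳ⁻ (wordᶠ n F) s
... | inj₁ t = noncrossingᶠ n F (u , t , m)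
... | inj₂ (_ , eq) = 1212-last m (All-resp-⊆ s (wordᵗ-above n T)) eq
noncrossingᶠ n [] (.[] , [] , m) with () ← matching-[] (matching-sym m)
noncrossingᶠ n (T ∷ F) o with occurs-++⁻ (wordᵗ n T) 1212-unsplittable (wordᵗ-≪-wordᶠ n T F) o
... | inj₁ o′ = noncrossingᵗ n T o′
... | inj₂ o′ = noncrossingᶠ _ F o′

fromForest-noncrossing : ∀ F → NonCrossing (fromForest F)
fromForest-noncrossing F c = noncrossingᶠ 0 F (contains⇒occurs {fromForest F} {p1212} c)

≤∧<suc⇒≡ : ∀ {n x} → n < x → x ≤ n + 1 → x ≡ suc n
≤∧<suc⇒≡ {n} {x} n<x x≤ = ≤-antisym (subst (x ≤_) (+-comm n 1) x≤) n<x

root∈wordᵗ : ∀ n T → suc n ∈ wordᵗ n T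
root∈wordᵗ n (node F) = ∈-++⁺ʳ (wordᶠ n F) (here refl)

letter∈wordᵗ : ∀ n T {x} → n < x → x ≤ n + leavesᵗ T → x ∈ wordᵗ n T
letter∈wordᶠ : ∀ n F {x} → n < x → x ≤ n + leavesᶠ F → x ∈ wordᶠ n F
letter∈wordᵗ n (node []) n<x x≤ = here (≤∧<suc⇒≡ n<x x≤)
letter∈wordᵗ n (node F@(_ ∷ _)) n<x x≤ = ∈-++⁺ˡ (letter∈wordᶠ n F n<x x≤)
letter∈wordᶠ n [] n<x x≤ = contradiction (subst (_ ≤_) (+-identityʳ n) x≤) (<⇒≱ n<x)
letter∈wordᶠ n (T ∷ F) {x} n<x x≤ with x ≤? n + leavesᵗ T
... | yes le = ∈-++⁺ˡ (letter∈wordᵗ n T n<x le)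
... | no gt = ∈-++⁺ʳ (wordᵗ n T)
  (letter∈wordᶠ _ F (≰⇒> gt) (subst (x ≤_) (sym (+-assoc n _ _)) x≤))

-- The obstruction to writing x once more: the subsequence y x y followed by x is a 1212.
Enclosed : ℕ → List ℕ → Set
Enclosed x w = ∃ λ y → y < x × (y ∷ x ∷ y ∷ []) ⊆ w

enclosed-⊆ : ∀ {x w w′} → w ⊆ w′ → Enclosed x w → Enclosed x w′
enclosed-⊆ s (y , lt , t) = y , lt , ⊆-trans t s

IsRoot : ℕ → ℕ → Forest → Set
IsRoot n x F = ∃ λ L → ∃₂ λ T R → F ≡ L ++ T ∷ R × x ≡ suc (n + leavesᶠ L)

-- The root repeats a letter of its first child, so every letter of the later children is caught
-- between two copies of `suc n`. Letters of the first child are settled by induction.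
root-or-enclosedᵗ : ∀ n T {x} → n < x → x ≤ n + leavesᵗ T → x ≡ suc n ⊎ Enclosed x (wordᵗ n T)
root-or-enclosedᵗ n (node []) n<x x≤ = inj₁ (≤∧<suc⇒≡ n<x x≤)
root-or-enclosedᵗ n (node (T ∷ F)) {x} n<x x≤ with x ≤? n + leavesᵗ T
... | yes le = Sum.map₂ (enclosed-⊆ (++⁺ʳ _ (++⁺ʳ _ ⊆-refl))) (root-or-enclosedᵗ n T n<x le)
... | no gt = inj₂ (suc n ,
  ≤-<-trans (≤-trans (≤-reflexive (+-comm 1 n)) (+-monoʳ-≤ n (leavesᵗ-positive T))) (≰⇒> gt) ,
  ++⁺ (++⁺ (from∈ (root∈wordᵗ n T))
           (from∈ (letter∈wordᶠ _ F (≰⇒> gt) (subst (x ≤_) (sym (+-assoc n _ _)) x≤)))) ⊆-refl)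

root-or-enclosedᶠ : ∀ n F {x} → n < x → x ≤ n + leavesᶠ F → IsRoot n x F ⊎ Enclosed x (wordᶠ n F)
root-or-enclosedᶠ n [] n<x x≤ = contradiction (subst (_ ≤_) (+-identityʳ n) x≤) (<⇒≱ n<x)
root-or-enclosedᶠ n (T ∷ F) {x} n<x x≤ with x ≤? n + leavesᵗ T
... | yes le = Sum.map
  (λ eq → [] , T , F , refl , trans eq (cong suc (sym (+-identityʳ n))))
  (enclosed-⊆ (++⁺ʳ _ ⊆-refl)) (root-or-enclosedᵗ n T n<x le)
... | no gt = Sum.map
  (λ { (L , T′ , R , refl , eq) → T ∷ L , T′ , R , refl , trans eq (cong suc (+-assoc n _ _)) })
  (enclosed-⊆ (++⁺ˡ (wordᵗ n T) ⊆-refl))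
  (root-or-enclosedᶠ _ F (≰⇒> gt) (subst (x ≤_) (sym (+-assoc n _ _)) x≤))

matching-1212 : ∀ {y x} → y < x → Matching (y ∷ x ∷ y ∷ x ∷ []) (word p1212)
matching-1212 {y} {x} y<x = matching ps refl refl λ m m′ → agree (which m) (which m′)
  where
  ps = (y , 1) ∷ (x , 2) ∷ (y , 1) ∷ (x , 2) ∷ []
  which : ∀ {p} → p ∈ ps → p ≡ (y , 1) ⊎ p ≡ (x , 2)
  which (here refl) = inj₁ refl
  which (there (here refl)) = inj₂ refl
  which (there (there (here refl))) = inj₁ refl
  which (there (there (there (here refl)))) = inj₂ refl
  agree : ∀ {p q} → p ≡ (y , 1) ⊎ p ≡ (x , 2) → q ≡ (y , 1) ⊎ q ≡ (x , 2) →
            proj₁ p < proj₁ q ⇔ proj₂ p < proj₂ q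
  agree (inj₁ refl) (inj₁ refl) = mk⇔ (⊥-elim ∘ <-irrefl refl) (⊥-elim ∘ <-irrefl refl)
  agree (inj₁ refl) (inj₂ refl) = mk⇔ (λ _ → ≤-refl) (λ _ → y<x)
  agree (inj₂ refl) (inj₁ refl) = mk⇔ (λ lt → contradiction lt (<-asym y<x)) (λ { (s≤s ()) })
  agree (inj₂ refl) (inj₂ refl) = mk⇔ (⊥-elim ∘ <-irrefl refl) (⊥-elim ∘ <-irrefl refl)

record Extension (S : Forest) (x : ℕ) : Set where
  field
    forest : Forest
    word≡ : wordᶠ 0 forest ≡ wordᶠ 0 S ++ x ∷ []
    leaves≡ : leavesᶠ forest ≡ leavesᶠ S ⊔ x

extend-fresh : ∀ S → Extension S (suc (leavesᶠ S))
extend-fresh S = record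
  { forest = S ++ node [] ∷ []
  ; word≡ = wordᶠ-++ 0 S _
  ; leaves≡ = trans (leavesᶠ-++ S _) (sym (⊔-fresh (leavesᶠ S)))
  }

-- Reading the letter of a root T again puts T and all trees after it under one new node. Its
-- leftmost leaf is that of T, so its letter is again x.
extend-root : ∀ S {x} → x ≤ leavesᶠ S → IsRoot 0 x S → Extension S x
extend-root S x≤ (L , T , R , refl , refl) = record
  { forest = L ++ node (T ∷ R) ∷ []
  ; word≡ = trans (wordᶠ-++ 0 L _) (trans (cong (wordᶠ 0 L ++_) (++-identityʳ _))
      (trans (sym (++-assoc (wordᶠ 0 L) _ _)) (cong (_++ _) (sym (wordᶠ-++ 0 L (T ∷ R))))))
  ; leaves≡ = trans (trans (leavesᶠ-++ L _) (trans (cong (leavesᶠ L +_) (+-identityʳ _))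
      (sym (leavesᶠ-++ L (T ∷ R))))) (sym (m≥n⇒m⊔n≡m x≤))
  }

extend : ∀ S {x} → 1 ≤ x → x ≤ suc (leavesᶠ S) → ¬ Enclosed x (wordᶠ 0 S) → Extension S x
extend S {x} 1≤x x≤ free with x ≤? leavesᶠ S
... | no gt with refl ← ≤-antisym x≤ (≰⇒> gt) = extend-fresh S
... | yes le with root-or-enclosedᶠ 0 S 1≤x le
... | inj₁ r = extend-root S le r
... | inj₂ e = contradiction e free

-- A shift-reduce parser with stack S: a new letter shifts a leaf, an old letter reduces. An old
-- letter that labels no root would be enclosed and would complete a 1212.
parse : ∀ S {w} → RestrictedGrowth (leavesᶠ S) w → ¬ Occurs (word p1212) (wordᶠ 0 S ++ w) →
        ∃ λ F → wordᶠ 0 S ++ w ≡ wordᶠ 0 F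
parse S [] _ = S , ++-identityʳ _
parse S (cons {x} {w} 1≤x x≤ g) free =
  let F , eq = parse forest (subst (λ k → RestrictedGrowth k w) (sym leaves≡) g)
                 (free ∘ subst (Occurs (word p1212)) (sym shifted))
  in F , trans shifted eq
  where
  open Extension (extend S 1≤x x≤ λ (y , y<x , s) →
    free (_ , ++⁺ s (refl ∷ minimum w) , matching-1212 y<x))
  shifted : wordᶠ 0 S ++ x ∷ w ≡ wordᶠ 0 forest ++ w
  shifted = trans (sym (++-assoc (wordᶠ 0 S) _ w)) (cong (_++ w) (sym word≡))

toForest : ∀ π → NonCrossing π → ∃ λ F → π ≡ fromForest F
toForest π nc =
  let F , eq = parse [] (isCanon π) (nc ∘ occurs⇒contains {π} {p1212}) in F , word-injective eq

suc∉wordᶠ : ∀ n T F → ¬ (suc n ∈ wordᶠ (n + leavesᵗ T) F)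
suc∉wordᶠ n T F m = <⇒≱ (All.lookup (wordᶠ-above _ F) m)
  (≤-trans (≤-reflexive (+-comm 1 n)) (+-monoʳ-≤ n (leavesᵗ-positive T)))

-- The last `suc n` in the word marks the end of the first tree, because later trees carry larger
-- letters only. Equal words are therefore cut at the same place.
wordᶠ-injective : ∀ n F G → wordᶠ n F ≡ wordᶠ n G → F ≡ G
wordᶠ-injective n [] [] _ = refl
wordᶠ-injective n [] (node G ∷ _) eq
  with () ← ++-conicalʳ (wordᶠ n G) _ (++-conicalˡ _ _ (sym eq))
wordᶠ-injective n (node F ∷ _) [] eq
  with () ← ++-conicalʳ (wordᶠ n F) _ (++-conicalˡ _ _ eq)
wordᶠ-injective n (T@(node F) ∷ F′) (U@(node G) ∷ G′) eq
  with ++-∷-trichotomy (wordᶠ n F) (wordᶠ n G)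
         (trans (sym (++-assoc (wordᶠ n F) _ _)) (trans eq (++-assoc (wordᶠ n G) _ _)))
... | inj₂ (inj₁ (_ , m)) = contradiction m (suc∉wordᶠ n T F′)
... | inj₂ (inj₂ (_ , m)) = contradiction m (suc∉wordᶠ n U G′)
... | inj₁ (p , _ , q) with refl ← wordᶠ-injective n F G p = cong (_ ∷_) (wordᶠ-injective _ F′ G′ q)

fromForest-injective : ∀ {F G} → fromForest F ≡ fromForest G → F ≡ G
fromForest-injective {F} {G} eq = wordᶠ-injective 0 F G (cong word eq)

-- Components are trees

tree-nonempty : ∀ T → NonEmpty (fromForest (T ∷ []))
tree-nonempty (node F) eq with () ← ++-conicalʳ (wordᶠ 0 F) _ (++-conicalˡ _ _ eq)

maxLetter-positive : ∀ {w} → RestrictedGrowth 0 w → w ≢ [] → 0 < maxLetter w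
maxLetter-positive [] ne = contradiction refl ne
maxLetter-positive (cons {x} a _ _) _ = ≤-trans a (m≤m⊔n x _)

-- A tree ends in the letter 1, whereas α [ β ] ends in a letter exceeding blocks α ≥ 1.
tree-connected : ∀ T → Connected (fromForest (T ∷ []))
tree-connected (node F) (α , β , α≠∅ , β≠∅ , eq)
  with ++-≡-∷ʳ (word α) (map (blocks α +_) (word β)) (trans (sym (cong word eq)) (++-identityʳ _))
... | inj₁ β≡[] = β≠∅ (map-[] (word β) β≡[])
  where
  map-[] : ∀ w → map (blocks α +_) w ≡ [] → w ≡ []
  map-[] [] _ = refl
... | inj₂ m with y , y∈β , p ← ∈-map⁻ (blocks α +_) m =
  <⇒≢ (+-mono-≤ (maxLetter-positive (isCanon α) α≠∅)
                (All.lookup (growth-positive (isCanon β)) y∈β)) p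

forest-components : ∀ F → HasComponentCount (fromForest F) (length F)
forest-components F = map tree F , (trees F , folds F) , length-map tree F
  where
  tree : Tree → Partition
  tree T = fromForest (T ∷ [])
  trees : ∀ F → All (λ σ → NonEmpty σ × Connected σ) (map tree F)
  trees [] = []
  trees (T ∷ F) = (tree-nonempty T , tree-connected T) ∷ trees F
  folds : ∀ F → fromForest F ≡ foldr _[_] ∅ (map tree F)
  folds [] = word-injective refl
  folds (T ∷ F) = trans (fromForest-++ (T ∷ []) F) (cong (tree T [_]) (folds F))

noncrossing-[]ˡ : ∀ α β → NonCrossing (α [ β ]) → NonCrossing α
noncrossing-[]ˡ α β nc (u , s , o) = nc (u , ++⁺ʳ _ s , o)

noncrossing-[]ʳ : ∀ α β → NonCrossing (α [ β ]) → NonCrossing β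
noncrossing-[]ʳ α β nc c = nc (occurs⇒contains {α [ β ]} {p1212}
  (occurs-⊆ (++⁺ˡ (word α) ⊆-refl) (occurs-shift⁺ (blocks α) (contains⇒occurs {β} {p1212} c))))

-- Each connected factor parses to exactly one tree: an empty forest contradicts nonemptiness, and
-- two or more trees would decompose it.
components-forest : ∀ σs → All (λ σ → NonEmpty σ × Connected σ) σs → NonCrossing (foldr _[_] ∅ σs) →
                    ∃ λ F → foldr _[_] ∅ σs ≡ fromForest F × length F ≡ length σs
components-forest [] [] _ = [] , word-injective refl , refl
components-forest (σ ∷ σs) ((ne , conn) ∷ ps) nc
  with toForest σ (noncrossing-[]ˡ σ (foldr _[_] ∅ σs) nc)
     | components-forest σs ps (noncrossing-[]ʳ σ (foldr _[_] ∅ σs) nc)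
... | [] , refl | _ = contradiction refl ne
... | T ∷ T′ ∷ G , refl | _ =
  contradiction (fromForest (T ∷ []) , fromForest (T′ ∷ G) ,
    tree-nonempty T , forest-nonempty T′ G , fromForest-++ (T ∷ []) (T′ ∷ G)) conn
  where
  forest-nonempty : ∀ T F → NonEmpty (fromForest (T ∷ F))
  forest-nonempty (node F) _ eq with () ← ++-conicalʳ (wordᶠ 0 F) _ (++-conicalˡ _ _ eq)
... | T ∷ [] , refl | F , eq , len =
  T ∷ F , trans (cong (fromForest (T ∷ []) [_]) eq) (sym (fromForest-++ (T ∷ []) F)) , cong suc len

component-count : ∀ F {m} → HasComponentCount (fromForest F) m ⇔ m ≡ length F
component-count F = mk⇔ to λ { refl → forest-components F }
  where
  to : ∀ {m} → HasComponentCount (fromForest F) m → m ≡ length F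
  to (σs , (ps , eq) , refl)
    with G , eq′ , len ← components-forest σs ps (subst NonCrossing eq (fromForest-noncrossing F))
    with refl ← fromForest-injective {F} {G} (trans eq eq′) = sym len

-- Subtrees in context

-- The siblings left and right of one node on the path. A list of levels, outermost first, is the
-- one-hole context of a zipper.
Level : Set
Level = Forest × Forest

plug : Tree → List Level → Tree
plug K [] = K
plug K ((L , R) ∷ zs) = node (L ++ plug K zs ∷ R)

children : Tree → Forest
children (node F) = F

data Side : Set where
  left right : Side

opposite : Side → Side
opposite left = right
opposite right = left

opposite-involutive : ∀ s → opposite (opposite s) ≡ s
opposite-involutive left = refl
opposite-involutive right = refl

-- Exchanging what stands left and right of a path

module _ {A : Set} where

  -- P and D in the order in which the word visits them: deeper levels come last on the left and
  -- first on the right.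
  beside : Side → List (List A × List A) → List A
  beside _ [] = []
  beside left ((L , R) ∷ zs) = L ++ beside left zs
  beside right ((L , R) ∷ zs) = beside right zs ++ R

  sizes : List (List A × List A) → List (ℕ × ℕ)
  sizes = map (Product.map length length)

  total : Side → List (ℕ × ℕ) → ℕ
  total left = foldr (λ (a , _) n → a + n) 0
  total right = foldr (λ (_ , b) n → n + b) 0

  length-beside : ∀ s zs → length (beside s zs) ≡ total s (sizes zs)
  length-beside left [] = refl
  length-beside right [] = refl
  length-beside left ((L , R) ∷ zs) = trans (length-++ L) (cong (length L +_) (length-beside left zs))
  length-beside right ((L , R) ∷ zs) =
    trans (length-++ (beside right zs)) (cong (_+ length R) (length-beside right zs))

  -- The inverse of passing to the sizes and the two sides. The outermost level takes its left trees
  -- from the front of P and its right trees from the back of D; the deeper levels need exactly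
  -- `total right ss` trees of D.
  fill : List (ℕ × ℕ) → List A → List A → List (List A × List A)
  fill [] _ _ = []
  fill ((a , b) ∷ ss) P D =
    (take a P , drop (total right ss) D) ∷ fill ss (drop a P) (take (total right ss) D)

  Fits : Side → List (ℕ × ℕ) → List A → Set
  Fits s ss X = length X ≡ total s ss

  fits-drop : ∀ {a b} ss {P} → Fits left ((a , b) ∷ ss) P → Fits left ss (drop a P)
  fits-drop {a} ss {P} fit = trans (length-drop a P) (trans (cong (_∸ a) fit) (m+n∸m≡n a _))

  fits-take : ∀ {a b} ss {D} → Fits right ((a , b) ∷ ss) D → Fits right ss (take (total right ss) D)
  fits-take ss {D} fit = trans (length-take (total right ss) D)
    (m≤n⇒m⊓n≡m (subst (total right ss ≤_) (sym fit) (m≤m+n _ _)))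

  empty-fits : ∀ {X : List A} → length X ≡ 0 → [] ≡ X
  empty-fits {[]} _ = refl

  fill-left : ∀ ss P D → Fits left ss P → beside left (fill ss P D) ≡ P
  fill-left [] P D fit = empty-fits fit
  fill-left ((a , b) ∷ ss) P D fit =
    trans (cong (take a P ++_) (fill-left ss (drop a P) _ (fits-drop {b = b} ss fit))) (take++drop≡id a P)

  fill-right : ∀ ss P D → Fits right ss D → beside right (fill ss P D) ≡ D
  fill-right [] P D fit = empty-fits fit
  fill-right ((a , b) ∷ ss) P D fit =
    trans (cong (_++ drop n D) (fill-right ss _ (take n D) (fits-take {a} {b} ss fit))) (take++drop≡id n D)
    where n = total right ss

  sizes-fill : ∀ ss P D → Fits left ss P → Fits right ss D → sizes (fill ss P D) ≡ ss
  sizes-fill [] P D _ _ = refl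
  sizes-fill ((a , b) ∷ ss) P D p d = cong₂ _∷_
    (cong₂ _,_
      (trans (length-take a P) (m≤n⇒m⊓n≡m (subst (a ≤_) (sym p) (m≤m+n a _))))
      (trans (length-drop n D) (trans (cong (_∸ n) d) (m+n∸m≡n n b))))
    (sizes-fill ss _ _ (fits-drop {b = b} ss p) (fits-take {a} {b} ss d))
    where n = total right ss

  take-length-++ : ∀ (X Y : List A) → take (length X) (X ++ Y) ≡ X
  take-length-++ [] Y = refl
  take-length-++ (x ∷ X) Y = cong (x ∷_) (take-length-++ X Y)

  drop-length-++ : ∀ (X Y : List A) → drop (length X) (X ++ Y) ≡ Y
  drop-length-++ [] Y = refl
  drop-length-++ (x ∷ X) Y = drop-length-++ X Y

  fill-sizes : ∀ zs → fill (sizes zs) (beside left zs) (beside right zs) ≡ zs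
  fill-sizes [] = refl
  fill-sizes ((L , R) ∷ zs)
    rewrite sym (length-beside right zs)
          | take-length-++ L (beside left zs) | drop-length-++ L (beside left zs)
          | take-length-++ (beside right zs) R | drop-length-++ (beside right zs) R
          = cong (_ ∷_) (fill-sizes zs)

  -- What stands left of the path moves to its right and vice versa; both keep their order,
  -- whereas the numbers of trees on the two sides are interchanged level by level.
  mirror : List (List A × List A) → List (List A × List A)
  mirror zs = fill (map Product.swap (sizes zs)) (beside right zs) (beside left zs)

  total-swap : ∀ s ss → total s (map Product.swap ss) ≡ total (opposite s) ss
  total-swap left [] = refl
  total-swap right [] = refl
  total-swap left ((a , b) ∷ ss) = trans (cong (b +_) (total-swap left ss)) (+-comm b _)
  total-swap right ((a , b) ∷ ss) = trans (cong (_+ a) (total-swap right ss)) (+-comm _ a)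

  mirror-fits : ∀ s zs → Fits s (map Product.swap (sizes zs)) (beside (opposite s) zs)
  mirror-fits s zs = trans (length-beside (opposite s) zs) (sym (total-swap s (sizes zs)))

  beside-mirror : ∀ s zs → beside s (mirror zs) ≡ beside (opposite s) zs
  beside-mirror left zs = fill-left (map Product.swap (sizes zs)) _ _ (mirror-fits left zs)
  beside-mirror right zs = fill-right (map Product.swap (sizes zs)) _ _ (mirror-fits right zs)

  sizes-mirror : ∀ zs → sizes (mirror zs) ≡ map Product.swap (sizes zs)
  sizes-mirror zs = sizes-fill (map Product.swap (sizes zs)) _ _ (mirror-fits left zs) (mirror-fits right zs)

  mirror-involutive : ∀ zs → mirror (mirror zs) ≡ zs
  mirror-involutive zs = begin
    fill (map Product.swap (sizes (mirror zs))) (beside right (mirror zs)) (beside left (mirror zs))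
      ≡⟨ cong₂ (fill _) (beside-mirror right zs) (beside-mirror left zs) ⟩
    fill (map Product.swap (sizes (mirror zs))) (beside left zs) (beside right zs)
      ≡⟨ cong (λ ss → fill ss (beside left zs) (beside right zs)) swapped ⟩
    fill (sizes zs) (beside left zs) (beside right zs)
      ≡⟨ fill-sizes zs ⟩
    zs ∎
    where
    open ≡-Reasoning
    swapped : map Product.swap (sizes (mirror zs)) ≡ sizes zs
    swapped = trans (cong (map Product.swap) (sizes-mirror zs))
      (trans (sym (map-∘ (sizes zs))) (map-id (sizes zs)))

  length-mirror : ∀ zs → length (mirror zs) ≡ length zs
  length-mirror zs = trans (sym (length-map _ (mirror zs))) (trans (cong length (sizes-mirror zs))
    (trans (length-map _ (sizes zs)) (length-map _ zs)))

-- The count sees the levels only through P, D and the length of the path, symmetrically in P and D;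
-- hence `mirror` preserves it.
nodes-plug : ∀ K zs →
  nodesᵗ (plug K zs) ≡ nodesᶠ (beside left zs) + nodesᶠ (beside right zs) + (nodesᵗ K + length zs)
nodes-plug K [] = sym (+-identityʳ _)
nodes-plug K ((L , R) ∷ zs)
  rewrite nodesᶠ-++ L (plug K zs ∷ R) | nodesᶠ-++ L (beside left zs) | nodesᶠ-++ (beside right zs) R
        | nodes-plug K zs =
  arith (nodesᶠ L) (nodesᶠ R) (nodesᶠ (beside left zs)) (nodesᶠ (beside right zs)) (nodesᵗ K) (length zs)
  where
  arith : ∀ l r p d k n → suc (l + ((p + d + (k + n)) + r)) ≡ (l + p) + (d + r) + (k + suc n)
  arith = solve-∀

nodes-mirror : ∀ K zs → nodesᵗ (plug K (mirror zs)) ≡ nodesᵗ (plug K zs)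
nodes-mirror K zs = begin
  nodesᵗ (plug K (mirror zs))
    ≡⟨ nodes-plug K (mirror zs) ⟩
  nodesᶠ (beside left (mirror zs)) + nodesᶠ (beside right (mirror zs)) + (nodesᵗ K + length (mirror zs))
    ≡⟨ cong₂ _+_ (cong₂ _+_ (cong nodesᶠ (beside-mirror left zs)) (cong nodesᶠ (beside-mirror right zs)))
                 (cong (nodesᵗ K +_) (length-mirror zs)) ⟩
  nodesᶠ (beside right zs) + nodesᶠ (beside left zs) + (nodesᵗ K + length zs)
    ≡⟨ cong (_+ (nodesᵗ K + length zs)) (+-comm (nodesᶠ (beside right zs)) _) ⟩
  nodesᶠ (beside left zs) + nodesᶠ (beside right zs) + (nodesᵗ K + length zs)
    ≡⟨ nodes-plug K zs ⟨
  nodesᵗ (plug K zs) ∎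
  where open ≡-Reasoning

length-children-plug : ∀ K L R zs →
  length (children (plug K ((L , R) ∷ zs))) ≡ suc (length L + length R)
length-children-plug K L R zs = trans (length-++ L) (+-suc (length L) (length R))

-- Here the exchange of counts level by level pays off: the degree at the top is one more than the
-- sum of the two counts of the first level. Applied to a virtual root, it preserves the number of
-- components.
length-children-mirror : ∀ K z zs →
  length (children (plug K (mirror (z ∷ zs)))) ≡ length (children (plug K (z ∷ zs)))
length-children-mirror K z@(L , R) zs = begin
  length (children (plug K (mirror (z ∷ zs))))  ≡⟨ length-children-plug K L′ R′ _ ⟩
  suc (length L′ + length R′)                   ≡⟨ cong suc (cong₂ _+_ (cong proj₁ heads) (cong proj₂ heads)) ⟩
  suc (length R + length L)                     ≡⟨ cong suc (+-comm (length R) (length L)) ⟩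
  suc (length L + length R)                     ≡⟨ length-children-plug K L R zs ⟨
  length (children (plug K (z ∷ zs)))           ∎
  where
  open ≡-Reasoning
  L′ = take (length R) (beside right (z ∷ zs))
  R′ = drop (total {Tree} right (map Product.swap (sizes zs))) (beside left (z ∷ zs))
  heads : (length L′ , length R′) ≡ (length R , length L)
  heads = ∷-injectiveˡ (sizes-mirror (z ∷ zs))

leaves-node : ∀ L T R → leavesᵗ (node (L ++ T ∷ R)) ≡ leavesᶠ (L ++ T ∷ R)
leaves-node [] T R = refl
leaves-node (_ ∷ _) T R = refl

leaves-plug : ∀ K zs →
  leavesᵗ (plug K zs) ≡ leavesᶠ (beside left zs) + leavesᵗ K + leavesᶠ (beside right zs)
leaves-plug K [] = sym (+-identityʳ _)
leaves-plug K ((L , R) ∷ zs)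
  rewrite leaves-node L (plug K zs) R | leavesᶠ-++ L (plug K zs ∷ R)
        | leavesᶠ-++ L (beside left zs) | leavesᶠ-++ (beside right zs) R | leaves-plug K zs =
  arith (leavesᶠ L) (leavesᶠ R) (leavesᶠ (beside left zs)) (leavesᶠ (beside right zs)) (leavesᵗ K)
  where
  arith : ∀ l r p d k → l + ((p + k + d) + r) ≡ (l + p) + k + (d + r)
  arith = solve-∀

-- The words of P, K and D inside the word of a tree

onset : ℕ → List Level → ℕ
onset n zs = n + leavesᶠ (beside left zs)

offset : ℕ → Tree → List Level → ℕ
offset n K zs = onset n zs + leavesᵗ K

onset-∷ : ∀ n L R zs → onset n ((L , R) ∷ zs) ≡ onset (n + leavesᶠ L) zs
onset-∷ n L R zs = trans (cong (n +_) (leavesᶠ-++ L (beside left zs))) (sym (+-assoc n _ _))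

offset-plug : ∀ n K zs → n + leavesᵗ (plug K zs) ≡ offset n K zs + leavesᶠ (beside right zs)
offset-plug n K zs rewrite leaves-plug K zs =
  arith n (leavesᶠ (beside left zs)) (leavesᵗ K) (leavesᶠ (beside right zs))
  where
  arith : ∀ n p k d → n + (p + k + d) ≡ n + p + k + d
  arith = solve-∀

beside-right-∷ : ∀ n K L R zs → let m = n + leavesᶠ L in
  wordᶠ (offset n K ((L , R) ∷ zs)) (beside right ((L , R) ∷ zs)) ≡
  wordᶠ (offset m K zs) (beside right zs) ++ wordᶠ (m + leavesᵗ (plug K zs)) R
beside-right-∷ n K L R zs = trans
  (cong (λ i → wordᶠ (i + leavesᵗ K) (beside right zs ++ R)) (onset-∷ n L R zs))
  (trans (wordᶠ-++ _ (beside right zs) R)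
    (cong (λ i → wordᶠ (offset m K zs) (beside right zs) ++ wordᶠ i R) (sym (offset-plug m K zs))))
  where m = n + leavesᶠ L

-- The word of `plug K zs` without the closing letters of the path nodes.
outline : ℕ → Tree → List Level → List ℕ
outline n K zs =
  wordᶠ n (beside left zs) ++ wordᵗ (onset n zs) K ++ wordᶠ (offset n K zs) (beside right zs)

outline-⊆ᵗ : ∀ n K zs → outline n K zs ⊆ wordᵗ n (plug K zs)
outline-⊆ᶠ : ∀ n K z zs → outline n K (z ∷ zs) ⊆ wordᶠ n (children (plug K (z ∷ zs)))
outline-⊆ᵗ n K [] = ⊆-reflexive (trans (++-identityʳ _) (cong (λ i → wordᵗ i K) (+-identityʳ n)))
outline-⊆ᵗ n K (z ∷ zs) = ++⁺ʳ _ (outline-⊆ᶠ n K z zs)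
outline-⊆ᶠ n K z@(L , R) zs = subst₂ _⊆_ (sym regroup) (sym (wordᶠ-++ n L _))
  (++⁺ (⊆-refl {x = wordᶠ n L}) (++⁺ (outline-⊆ᵗ m K zs) (⊆-refl {x = wordᶠ (m + leavesᵗ (plug K zs)) R})))
  where
  m = n + leavesᶠ L
  wL = wordᶠ n L
  wP = wordᶠ m (beside left zs)
  wK = wordᵗ (onset m zs) K
  wD = wordᶠ (offset m K zs) (beside right zs)
  wR = wordᶠ (m + leavesᵗ (plug K zs)) R
  open ≡-Reasoning
  regroup : outline n K (z ∷ zs) ≡ wL ++ (wP ++ wK ++ wD) ++ wR
  regroup = begin
    outline n K (z ∷ zs)
      ≡⟨ cong₂ _++_ (wordᶠ-++ n L (beside left zs))
           (cong₂ _++_ (cong (λ i → wordᵗ i K) (onset-∷ n L R zs)) (beside-right-∷ n K L R zs)) ⟩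
    (wL ++ wP) ++ wK ++ wD ++ wR  ≡⟨ ++-assoc wL wP _ ⟩
    wL ++ wP ++ wK ++ wD ++ wR    ≡⟨ cong (λ w → wL ++ wP ++ w) (++-assoc wK wD wR) ⟨
    wL ++ wP ++ (wK ++ wD) ++ wR  ≡⟨ cong (wL ++_) (++-assoc wP (wK ++ wD) wR) ⟨
    wL ++ (wP ++ wK ++ wD) ++ wR  ∎

-- Occurrences in trees and forests

Occursᵗ : List ℕ → Tree → Set
Occursᵗ p T = Occurs p (wordᵗ 0 T)

Occursᶠ : List ℕ → Forest → Set
Occursᶠ p F = Occurs p (wordᶠ 0 F)

wordᵗ-0 : ∀ n T → wordᵗ n T ≡ map (n +_) (wordᵗ 0 T)
wordᵗ-0 n T = trans (cong (λ k → wordᵗ k T) (sym (+-identityʳ n))) (wordᵗ-shift n 0 T)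

wordᶠ-0 : ∀ n F → wordᶠ n F ≡ map (n +_) (wordᶠ 0 F)
wordᶠ-0 n F = trans (cong (λ k → wordᶠ k F) (sym (+-identityʳ n))) (wordᶠ-shift n 0 F)

module _ {p : List ℕ} where

  occursᵗ-at : ∀ n T → Occursᵗ p T → Occurs p (wordᵗ n T)
  occursᵗ-at n T = subst (Occurs p) (sym (wordᵗ-0 n T)) ∘ occurs-shift⁺ n

  occursᶠ-at : ∀ n F → Occursᶠ p F → Occurs p (wordᶠ n F)
  occursᶠ-at n F = subst (Occurs p) (sym (wordᶠ-0 n F)) ∘ occurs-shift⁺ n

  occursᶠ-from : ∀ n F → Occurs p (wordᶠ n F) → Occursᶠ p F
  occursᶠ-from n F = occurs-shift⁻ n ∘ subst (Occurs p) (wordᶠ-0 n F)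

  occurs-node : ∀ F → Occursᶠ p F → Occursᵗ p (node F)
  occurs-node F = occurs-⊆ (++⁺ʳ _ ⊆-refl)

  occurs-++ˡ : ∀ F G → Occursᶠ p F → Occursᶠ p (F ++ G)
  occurs-++ˡ F G = occurs-⊆ (subst (wordᶠ 0 F ⊆_) (sym (wordᶠ-++ 0 F G)) (++⁺ʳ _ ⊆-refl))

  occurs-++ʳ : ∀ F G → Occursᶠ p G → Occursᶠ p (F ++ G)
  occurs-++ʳ F G = occurs-⊆ (subst (wordᶠ (leavesᶠ F) G ⊆_) (sym (wordᶠ-++ 0 F G)) (++⁺ˡ (wordᶠ 0 F) ⊆-refl))
                 ∘ occursᶠ-at (leavesᶠ F) G

  occurs-∈ : ∀ {T F} → T ∈ F → Occursᵗ p T → Occursᶠ p F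
  occurs-∈ {F = T ∷ F} (here refl) = occurs-⊆ (++⁺ʳ _ ⊆-refl)
  occurs-∈ {F = T ∷ F} (there m) = occurs-++ʳ (T ∷ []) F ∘ occurs-∈ m

  occurs-plug : ∀ K zs → Occursᵗ p K → Occursᵗ p (plug K zs)
  occurs-plug K [] = id
  occurs-plug K ((L , R) ∷ zs) =
    occurs-node (L ++ plug K zs ∷ R) ∘ occurs-∈ (∈-++⁺ʳ L (here refl)) ∘ occurs-plug K zs

  occurs-children-plug : ∀ K z zs → Occursᵗ p K → Occursᶠ p (children (plug K (z ∷ zs)))
  occurs-children-plug K (L , R) zs = occurs-∈ (∈-++⁺ʳ L (here refl)) ∘ occurs-plug K zs

  module _ (unsplittable : Unsplittable p) where

    occurs-∷⁻ : ∀ T F → Occursᶠ p (T ∷ F) → Occursᵗ p T ⊎ Occursᶠ p F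
    occurs-∷⁻ T F o = Sum.map₂ (occursᶠ-from _ F)
      (occurs-++⁻ (wordᵗ 0 T) unsplittable (wordᵗ-≪-wordᶠ 0 T F) o)

    occurs-++-forest⁻ : ∀ F G → Occursᶠ p (F ++ G) → Occursᶠ p F ⊎ Occursᶠ p G
    occurs-++-forest⁻ F G o = Sum.map₂ (occursᶠ-from _ G)
      (occurs-++⁻ (wordᶠ 0 F) unsplittable (wordᶠ-≪-wordᶠ 0 F G) (subst (Occurs p) (wordᶠ-++ 0 F G) o))

-- The involution

module Involution (p : List ℕ) (unsplittable : Unsplittable p) (p≢[] : p ≢ []) where

  -- Minimality is asked of the forest of children as a whole; every copy of p in K then uses the
  -- root of K.
  Critical : Tree → Set
  Critical K = Occursᵗ p K × ¬ Occursᶠ p (children K)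

  Clear : Side → List Level → Set
  Clear s zs = ¬ Occursᶠ p (beside s zs)

  record Locatedᵗ (s : Side) (T : Tree) : Set where
    constructor located
    field
      core     : Tree
      levels   : List Level
      plugged  : T ≡ plug core levels
      critical : Critical core
      clear    : Clear s levels

  -- The forest is read as the children of a virtual root. The separate top level keeps the core
  -- strictly below that root.
  record Locatedᶠ (s : Side) (F : Forest) : Set where
    constructor located
    field
      core     : Tree
      top      : Level
      levels   : List Level
      plugged  : F ≡ children (plug core (top ∷ levels))
      critical : Critical core
      clear    : Clear s (top ∷ levels)

  free-[] : ¬ Occursᶠ p []
  free-[] (_ , [] , m) = p≢[] (matching-[] (matching-sym m))

  free-++ : ∀ F G → ¬ Occursᶠ p F → ¬ Occursᶠ p G → ¬ Occursᶠ p (F ++ G)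
  free-++ F G f g o with occurs-++-forest⁻ unsplittable F G o
  ... | inj₁ o′ = f o′
  ... | inj₂ o′ = g o′

  free-∷ : ∀ T F → ¬ Occursᵗ p T → ¬ Occursᶠ p F → ¬ Occursᶠ p (T ∷ F)
  free-∷ T F f g o with occurs-∷⁻ unsplittable T F o
  ... | inj₁ o′ = f o′
  ... | inj₂ o′ = g o′

  ∷-head : ∀ s {T} F → (s ≡ right → ¬ Occursᶠ p F) → Locatedᵗ s T → Locatedᶠ s (T ∷ F)
  ∷-head left F _ (located K zs refl crit clear) = located K ([] , F) zs refl crit clear
  ∷-head right F free (located K zs refl crit clear) =
    located K ([] , F) zs refl crit (free-++ (beside right zs) F clear (free refl))

  ∷-tail : ∀ s T {F} → (s ≡ left → ¬ Occursᵗ p T) → Locatedᶠ s F → Locatedᶠ s (T ∷ F)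
  ∷-tail left T free (located K (L , R) zs refl crit clear) =
    located K (T ∷ L , R) zs refl crit (free-∷ T (beside left ((L , R) ∷ zs)) (free refl) clear)
  ∷-tail right T _ (located K (L , R) zs refl crit clear) = located K (T ∷ L , R) zs refl crit clear

  close : ∀ {s F} → Locatedᶠ s F → Locatedᵗ s (node F)
  close (located K z zs refl crit clear) = located K (z ∷ zs) refl crit clear

  free-beside-[] : ∀ s → Clear s []
  free-beside-[] left = free-[]
  free-beside-[] right = free-[]

  -- Existence of K: at each level the path enters the first tree containing p for `left`, the last
  -- one for `right`. The trees passed over on that side are free of p, and so is their
  -- concatenation, because p is unsplittable.
  locateᵗ : ∀ s T → Occursᵗ p T → Locatedᵗ s T
  locateᶠ : ∀ s F → Occursᶠ p F → Locatedᶠ s F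
  locateᵗ s (node F) o with occurs? p (wordᶠ 0 F)
  ... | no free = located (node F) [] refl (o , free) (free-beside-[] s)
  ... | yes o′ = close (locateᶠ s F o′)
  locateᶠ s [] o = contradiction o free-[]
  locateᶠ left (T ∷ F) o with occurs? p (wordᵗ 0 T)
  ... | yes oT = ∷-head left F (λ ()) (locateᵗ left T oT)
  ... | no free with occurs-∷⁻ unsplittable T F o
  ... | inj₁ oT = contradiction oT free
  ... | inj₂ oF = ∷-tail left T (λ _ → free) (locateᶠ left F oF)
  locateᶠ right (T ∷ F) o with occurs? p (wordᶠ 0 F)
  ... | yes oF = ∷-tail right T (λ ()) (locateᶠ right F oF)
  ... | no free with occurs-∷⁻ unsplittable T F o
  ... | inj₁ oT = ∷-head right F (λ _ → free) (locateᵗ right T oT)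
  ... | inj₂ oF = contradiction oF free

  clear-levels : ∀ s {L R zs} → Clear s ((L , R) ∷ zs) → Clear s zs
  clear-levels left {L} clear = clear ∘ occurs-++ʳ L _
  clear-levels right {L} {R} {zs} clear = clear ∘ occurs-++ˡ (beside right zs) R

  not-in-sibling : ∀ s {L R zs L′ R′ zs′ T T′} → Clear s ((L , R) ∷ zs) → Clear s ((L′ , R′) ∷ zs′) →
                   Occursᵗ p T → Occursᵗ p T′ → ¬ (T ∈ L′ × T′ ∈ R)
  not-in-sibling left {L′ = L′} _ clear o _ (m , _) = clear (occurs-++ˡ L′ _ (occurs-∈ m o))
  not-in-sibling right {zs = zs} clear _ _ o (_ , m) =
    clear (occurs-++ʳ (beside right zs) _ (occurs-∈ m o))

  -- Minimality forbids that one core lies properly inside the other. If the paths part at siblings,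
  -- the left core spoils the left side of the right path, and the right core spoils the right side
  -- of the left path; either way the chosen side is not clear.
  plug-unique : ∀ s {K K′} zs zs′ → Critical K → Critical K′ → Clear s zs → Clear s zs′ →
                plug K zs ≡ plug K′ zs′ → K ≡ K′ × zs ≡ zs′
  plug-unique s [] [] _ _ _ _ eq = eq , refl
  plug-unique s {K′ = K′} [] (z ∷ zs′) (_ , free) (o , _) _ _ refl =
    contradiction (occurs-children-plug K′ z zs′ o) free
  plug-unique s {K} (z ∷ zs) [] (o , _) (_ , free) _ _ refl =
    contradiction (occurs-children-plug K z zs o) free
  plug-unique s {K} {K′} ((L , R) ∷ zs) ((L′ , R′) ∷ zs′) crit crit′ clear clear′ eq
    with ++-∷-trichotomy L L′ (cong children eq)
  ... | inj₂ (inj₁ ms) = contradiction ms (not-in-sibling s clear clear′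
          (occurs-plug K zs (proj₁ crit)) (occurs-plug K′ zs′ (proj₁ crit′)))
  ... | inj₂ (inj₂ (m , m′)) = contradiction (m , m′) (not-in-sibling s clear′ clear
          (occurs-plug K′ zs′ (proj₁ crit′)) (occurs-plug K zs (proj₁ crit)))
  ... | inj₁ (refl , eq′ , refl)
    with plug-unique s zs zs′ crit crit′ (clear-levels s clear) (clear-levels s clear′) eq′
  ... | refl , refl = refl , refl

  reflect : ∀ {s F} → Locatedᶠ s F → Forest
  reflect (located K z zs _ _ _) = children (plug K (mirror (z ∷ zs)))

  flip-dec : ∀ s F → Dec (Occursᶠ p F) → Forest
  flip-dec s F (no _) = F
  flip-dec s F (yes o) = reflect (locateᶠ s F o)

  flip : Side → Forest → Forest
  flip s F = flip-dec s F (occurs? p (wordᶠ 0 F))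

  data FlipView (s : Side) (F : Forest) : Forest → Set where
    unmoved   : ¬ Occursᶠ p F → FlipView s F F
    reflected : (l : Locatedᶠ s F) → FlipView s F (reflect l)

  flip-view : ∀ s F → FlipView s F (flip s F)
  flip-view s F with occurs? p (wordᶠ 0 F)
  ... | no ¬o = unmoved ¬o
  ... | yes o = reflected (locateᶠ s F o)

  flip-free : ∀ s {F} → ¬ Occursᶠ p F → flip s F ≡ F
  flip-free s {F} ¬o with occurs? p (wordᶠ 0 F)
  ... | no _ = refl
  ... | yes o = contradiction o ¬o

  -- By uniqueness the result does not depend on how K was found, so the reverse flip may start from
  -- the mirrored location instead of searching again.
  flip-located : ∀ s {F} (l : Locatedᶠ s F) → flip s F ≡ reflect l
  flip-located s {F} (located K z zs eq crit clear) with occurs? p (wordᶠ 0 F)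
  ... | no ¬o = contradiction (subst (Occursᶠ p) (sym eq) (occurs-children-plug K z zs (proj₁ crit))) ¬o
  ... | yes o with locateᶠ s F o
  ... | located K′ z′ zs′ eq′ crit′ clear′
    with refl , refl ← plug-unique s (z′ ∷ zs′) (z ∷ zs) crit′ crit clear′ clear
                         (cong node (trans (sym eq′) eq)) = refl

  reflect-located : ∀ s {F} (l : Locatedᶠ s F) → Locatedᶠ (opposite s) (reflect l)
  reflect-located s (located K z zs _ crit clear) = located K _ _ refl crit
    (clear ∘ subst (Occursᶠ p) (trans (beside-mirror (opposite s) (z ∷ zs))
      (cong (λ t → beside t (z ∷ zs)) (opposite-involutive s))))

  reflect-involutive : ∀ s {F} (l : Locatedᶠ s F) → reflect (reflect-located s l) ≡ F
  reflect-involutive s (located K z zs refl _ _) =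
    cong (children ∘ plug K) (mirror-involutive (z ∷ zs))

  flip-involutive : ∀ s F → flip (opposite s) (flip s F) ≡ F
  flip-involutive s F with flip s F | flip-view s F
  ... | _ | unmoved ¬o = flip-free (opposite s) ¬o
  ... | _ | reflected l =
    trans (flip-located (opposite s) (reflect-located s l)) (reflect-involutive s l)

  length-flip : ∀ s F → length (flip s F) ≡ length F
  length-flip s F with flip s F | flip-view s F
  ... | _ | unmoved _ = refl
  ... | _ | reflected (located K z zs refl _ _) = length-children-mirror K z zs

  nodes-flip : ∀ s F → nodesᶠ (flip s F) ≡ nodesᶠ F
  nodes-flip s F with flip s F | flip-view s F
  ... | _ | unmoved _ = refl
  ... | _ | reflected (located K z zs refl _ _) = suc-injective (nodes-mirror K (z ∷ zs))

  -- A used root would be the last letter of a nonempty v and thus exceed the letters of u, yet it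
  -- is the least letter of the tree.
  root-last : ∀ n T {u v} → u ≪ v → u ++ v ⊆ wordᵗ n T →
              u ≡ [] ⊎ v ≡ [] ⊎ u ++ v ⊆ wordᶠ n (children T)
  root-last n T@(node F) {u} {v} u≪v s with ⊆-∷ʳ⁻ (wordᶠ n F) s
  ... | inj₁ t = inj₂ (inj₂ t)
  ... | inj₂ (_ , eq) with ++-≡-∷ʳ u v eq
  ... | inj₁ v≡[] = inj₂ (inj₁ v≡[])
  root-last n T {[]} u≪v s | inj₂ _ | inj₂ _ = inj₁ refl
  root-last n T {x ∷ _} (x<v ∷ _) s | inj₂ _ | inj₂ m =
    contradiction (All.lookup x<v m) (≤⇒≯ (All.head (All-resp-⊆ s (wordᵗ-above n T))))

  nonempty-match : ∀ {u} {A : Set} → Matching u p → u ≡ [] → A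
  nonempty-match m refl = contradiction (matching-[] (matching-sym m)) p≢[]

  -- Follow the path down. The copy u of p cannot lie in L, which is clear, so it lies in the next
  -- tree of the path or in R. In the latter case v lies in R as well; in the former v may be cut
  -- between that tree and R, and the descent continues. On arrival at K, minimality leaves no room
  -- for u with a nonempty v behind it.
  after : ∀ n K zs {u v} → Matching u p → u ≪ v → Critical K → Clear left zs →
          u ++ v ⊆ wordᵗ n (plug K zs) → v ⊆ wordᶠ (offset n K zs) (beside right zs)
  after n K zs m u≪v crit clear s with root-last n (plug K zs) u≪v s
  after n K zs m _ _ _ _ | inj₁ u≡[] = nonempty-match m u≡[]
  after n K zs _ _ _ _ _ | inj₂ (inj₁ refl) = minimum _
  after n K [] {v = v} m _ (_ , free) _ _ | inj₂ (inj₂ t) =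
    contradiction (occursᶠ-from n (children K) (_ , ⊆-trans (++⁺ʳ v ⊆-refl) t , m)) free
  after n K ((L , R) ∷ zs) {u} {v} m u≪v crit clear _ | inj₂ (inj₂ t)
    with unsplittable-++-⊆ (wordᶠ n L) (unsplittable-matching unsplittable m)
           (wordᶠ-≪-wordᶠ n L (plug K zs ∷ R)) (subst (u ++ v ⊆_) (wordᶠ-++ n L _) t)
  ... | inj₁ (v₁ , _ , refl , t₁ , _) = contradiction
          (occurs-++ˡ L (beside left zs) (occursᶠ-from n L (u , ⊆-trans (++⁺ʳ v₁ ⊆-refl) t₁ , m))) clear
  ... | inj₂ t′
    with unsplittable-++-⊆ (wordᵗ _ (plug K zs)) (unsplittable-matching unsplittable m)
           (wordᵗ-≪-wordᶠ _ (plug K zs) R) t′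
  ... | inj₁ (v₁ , v₂ , refl , t₁ , t₂) = subst (v ⊆_) (sym (beside-right-∷ n K L R zs))
          (++⁺ (after _ K zs m (≪-resp-⊆ ⊆-refl (++⁺ʳ v₂ ⊆-refl) u≪v) crit
                  (clear-levels left {L} {R} {zs} clear) t₁) t₂)
  ... | inj₂ t″ = subst (v ⊆_) (sym (beside-right-∷ n K L R zs))
          (++⁺ˡ (wordᶠ (offset _ K zs) (beside right zs)) (⊆-trans (++⁺ˡ u ⊆-refl) t″))

  -- The mirror image of `after`: now R is clear, and v may be cut between L and the next tree of
  -- the path.
  before : ∀ n K zs {v u} → Matching u p → v ≪ u → Critical K → Clear right zs →
           v ++ u ⊆ wordᵗ n (plug K zs) → v ⊆ wordᶠ n (beside left zs)
  before n K zs m v≪u crit clear s with root-last n (plug K zs) v≪u s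
  before n K zs _ _ _ _ _ | inj₁ refl = minimum _
  before n K zs m _ _ _ _ | inj₂ (inj₁ u≡[]) = nonempty-match m u≡[]
  before n K [] {v} m _ (_ , free) _ _ | inj₂ (inj₂ t) =
    contradiction (occursᶠ-from n (children K) (_ , ⊆-trans (++⁺ˡ v ⊆-refl) t , m)) free
  before n K ((L , R) ∷ zs) {v} {u} m v≪u crit clear _ | inj₂ (inj₂ t)
    with ++-unsplittable-⊆ v (wordᶠ n L) (unsplittable-matching unsplittable m)
           (wordᶠ-≪-wordᶠ n L (plug K zs ∷ R)) (subst (v ++ u ⊆_) (wordᶠ-++ n L _) t)
  ... | inj₁ t₁ = subst (v ⊆_) (sym (wordᶠ-++ n L _)) (++⁺ʳ _ (⊆-trans (++⁺ʳ u ⊆-refl) t₁))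
  ... | inj₂ (v₁ , v₂ , refl , t₁ , t₂)
    with ++-unsplittable-⊆ v₂ (wordᵗ _ (plug K zs)) (unsplittable-matching unsplittable m)
           (wordᵗ-≪-wordᶠ _ (plug K zs) R) t₂
  ... | inj₁ t₃ = subst (v ⊆_) (sym (wordᶠ-++ n L _))
          (++⁺ t₁ (before _ K zs m (≪-resp-⊆ (++⁺ˡ v₁ ⊆-refl) ⊆-refl v≪u) crit
                     (clear-levels right {L} {R} {zs} clear) t₃))
  ... | inj₂ (_ , v₄ , refl , _ , t₄) = contradiction
          (occurs-++ʳ (beside right zs) R (occursᶠ-from _ R (u , ⊆-trans (++⁺ˡ v₄ ⊆-refl) t₄ , m))) clear

-- Avoidance

≪-shift : ∀ u {v} → All (0 <_) v → u ≪ map (maxLetter u +_) v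
≪-shift u 0<v = ≪-between (≤-maxLetter u)
  (Allₚ.map⁺ (All.map (λ {x} 0<x → subst (_< maxLetter u + x) (+-identityʳ _) (+-monoʳ-< _ 0<x)) 0<v))

[]-≪ : ∀ α β → word α ≪ map (blocks α +_) (word β)
[]-≪ α β = ≪-shift (word α) (growth-positive (isCanon β))

occurs-[] : ∀ α β {w} → Occurs (word (α [ β ])) w →
            ∃₂ λ u v → u ++ v ⊆ w × u ≪ v × Matching u (word α) × Matching v (word β)
occurs-[] α β (_ , s , m) with u , v , refl , m₁ , m₂ , f ← matching-++⁻ (word α) m =
  u , v , s , f ([]-≪ α β) , m₁ , matching-unshift (blocks α) m₂

matching-concat : ∀ α β {u v} → u ≪ v → Matching u (word α) → Matching v (word β) →
               Matching (u ++ v) (word (α [ β ]))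
matching-concat α β u≪v m₁ m₂ = matching-++⁺ u≪v ([]-≪ α β) m₁ (matching-shift (blocks α) m₂)

module Avoidance (σ ρ : Partition) (connected : Connected σ) (σ≢∅ : NonEmpty σ) where

  open Involution (word σ) (connected⇒unsplittable connected) σ≢∅

  pattern-for : Side → Partition
  pattern-for left = σ [ ρ ]
  pattern-for right = ρ [ σ ]

  -- Settles the forests without σ: they avoid both patterns and may stay fixed.
  pattern-σ : ∀ s {w} → Occurs (word (pattern-for s)) w → Occurs (word σ) w
  pattern-σ left o with u , v , s , _ , m , _ ← occurs-[] σ ρ o = u , ⊆-trans (++⁺ʳ v ⊆-refl) s , m
  pattern-σ right o with u , v , s , _ , _ , m ← occurs-[] ρ σ o = v , ⊆-trans (++⁺ˡ u ⊆-refl) s , m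

  pattern-beside : ∀ s K z zs → Critical K → Clear s (z ∷ zs) →
    Occursᶠ (word (pattern-for s)) (children (plug K (z ∷ zs))) →
    Occursᶠ (word ρ) (beside (opposite s) (z ∷ zs))
  pattern-beside left K z zs crit clear o with u , v , s , u≪v , m₁ , m₂ ← occurs-[] σ ρ o =
    occursᶠ-from _ (beside right (z ∷ zs))
      -- `after` speaks of trees, so the letter of the virtual root is appended to the word of the
      -- forest.
      (v , after 0 K (z ∷ zs) m₁ u≪v crit clear (++⁺ʳ _ s) , m₂)
  pattern-beside right K z zs crit clear o with v , u , s , v≪u , m₂ , m₁ ← occurs-[] ρ σ o =
    v , before 0 K (z ∷ zs) m₁ v≪u crit clear (++⁺ʳ _ s) , m₂

  -- K supplies the copy of σ. The whole of D comes after K with larger letters, and the whole of P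
  -- before K with smaller ones, so any copy of ρ there completes the pattern.
  beside-pattern : ∀ s K z zs → Critical K → Occursᶠ (word ρ) (beside (opposite s) (z ∷ zs)) →
    Occursᶠ (word (pattern-for s)) (children (plug K (z ∷ zs)))
  beside-pattern left K z zs (oK , _) oR
    with u , s , m ← occursᵗ-at (onset 0 (z ∷ zs)) K oK
       | v , t , m′ ← occursᶠ-at (offset 0 K (z ∷ zs)) (beside right (z ∷ zs)) oR =
    u ++ v , ⊆-trans (++⁺ˡ (wordᶠ 0 (beside left (z ∷ zs))) (++⁺ s t)) (outline-⊆ᶠ 0 K z zs) ,
    matching-concat σ ρ (≪-resp-⊆ s t (wordᵗ-≪-wordᶠ _ K (beside right (z ∷ zs)))) m m′
  beside-pattern right K z zs (oK , _) (v , t , m′)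
    with u , s , m ← occursᵗ-at (onset 0 (z ∷ zs)) K oK =
    v ++ u , ⊆-trans (++⁺ t (++⁺ʳ _ s)) (outline-⊆ᶠ 0 K z zs) ,
    matching-concat ρ σ
      (≪-resp-⊆ t s (≪-between (wordᶠ-below 0 (beside left (z ∷ zs))) (wordᵗ-above _ K))) m′ m

  -- A forbidden pattern in the image yields a copy of ρ on side s of the new path. As a list of
  -- trees this is side `opposite s` of the old path, where ρ completes the pattern avoided by F.
  flip-avoids : ∀ s F → ¬ Occursᶠ (word (pattern-for s)) F →
                ¬ Occursᶠ (word (pattern-for (opposite s))) (flip s F)
  flip-avoids s F avoids o with flip s F | flip-view s F
  ... | _ | unmoved ¬o = ¬o (pattern-σ (opposite s) o)
  ... | _ | reflected l@(located K z zs refl crit clear) =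
    avoids (beside-pattern s K z zs crit
      (subst (Occursᶠ (word ρ)) (trans (beside-mirror (opposite (opposite s)) (z ∷ zs))
          (cong (λ t → beside (opposite t) (z ∷ zs)) (opposite-involutive s)))
        (pattern-beside (opposite s) K _ _ crit (Locatedᶠ.clear (reflect-located s l)) o)))

  -- The bijection between the two classes of avoiders

  Avoider : Side → Set
  Avoider s = NonCrossingAvoiders (pattern-for s)

  -- Parsing needs a usable proof of non-crossing, while the refinement stores an irrelevant one;
  -- being a negation, it can be recomputed.
  forestOf : ∀ s → Avoider s → Forest
  forestOf s (π , Irr.[ p ]) = proj₁ (toForest π (¬-recompute (proj₁ p)))

  forestOf-value : ∀ s (a : Avoider s) → value a ≡ fromForest (forestOf s a)
  forestOf-value s (π , Irr.[ p ]) = proj₂ (toForest π (¬-recompute (proj₁ p)))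

  forestOf-avoids : ∀ s (a : Avoider s) → ¬ Occursᶠ (word (pattern-for s)) (forestOf s a)
  forestOf-avoids s a@(π , Irr.[ p ]) o = ¬-recompute (proj₂ p) (occurs⇒contains {π} {pattern-for s}
    (subst (Occurs (word (pattern-for s)) ∘ word) (sym (forestOf-value s a)) o))

  avoider : ∀ s F → ¬ Occursᶠ (word (pattern-for s)) F → Avoider s
  avoider s F avoids = fromForest F , Irr.[ fromForest-noncrossing F ,
    avoids ∘ contains⇒occurs {fromForest F} {pattern-for s} ]

  forestOf-≡ : ∀ s (a : Avoider s) {F} → value a ≡ fromForest F → forestOf s a ≡ F
  forestOf-≡ s a {F} eq = fromForest-injective {forestOf s a} {F} (trans (sym (forestOf-value s a)) eq)

  flipped : ∀ s → Avoider s → Avoider (opposite s)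
  flipped s a = avoider (opposite s) (flip s (forestOf s a)) (flip-avoids s (forestOf s a) (forestOf-avoids s a))

  flipped-inverse : ∀ s a (b : Avoider s) → value b ≡ value (flipped (opposite s) (flipped s a)) → b ≡ a
  flipped-inverse s a b eq = value-injective (trans eq (trans (cong fromForest back) (sym (forestOf-value s a))))
    where
    back : flip (opposite s) (forestOf (opposite s) (flipped s a)) ≡ forestOf s a
    back = trans (cong (flip (opposite s)) (forestOf-≡ (opposite s) (flipped s a) {flip s (forestOf s a)} refl))
                 (flip-involutive s (forestOf s a))

  bijection : Avoider left ⤖ Avoider right
  bijection = ↔⇒⤖ (mk↔ₛ′ (flipped left) (flipped right)
    (λ a → flipped-inverse right a _ refl) (λ a → flipped-inverse left a _ refl))

  flip-size : ∀ F → size (fromForest (flip left F)) ≡ size (fromForest F)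
  flip-size F = trans (length-wordᶠ 0 (flip left F)) (trans (nodes-flip left F) (sym (length-wordᶠ 0 F)))

  flip-components : ∀ F m →
    HasComponentCount (fromForest F) m ⇔ HasComponentCount (fromForest (flip left F)) m
  flip-components F m = ⇔-trans (component-count F) (⇔-trans
    (mk⇔ (λ eq → trans eq (sym (length-flip left F))) (λ eq → trans eq (length-flip left F)))
    (⇔-sym (component-count (flip left F))))

  ccEquivalent : CCEquivalent (σ [ ρ ]) (ρ [ σ ])
  ccEquivalent = bijection , λ a → let F = forestOf left a; eq = forestOf-value left a in
    trans (flip-size F) (cong size (sym eq)) ,
    λ m → subst (λ π → HasComponentCount π m ⇔ HasComponentCount (fromForest (flip left F)) m)
            (sym eq) (flip-components F m)

CC-refl : ∀ {σ τ} → σ ≡ τ → CCEquivalent σ τ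
CC-refl {σ} refl = ⤖-id (NonCrossingAvoiders σ) , λ _ → refl , λ _ → mk⇔ id id

theorem3p3 : (σ ρ : Partition) → NonCrossing σ → NonCrossing ρ → Connected σ →
    CCEquivalent (σ [ ρ ]) (ρ [ σ ])
-- The empty partition satisfies `Connected`, but an empty pattern has no critical subtree. Here
-- both composites equal ρ.
theorem3p3 (partition [] []) ρ _ _ _ = CC-refl {∅ [ ρ ]} {ρ [ ∅ ]}
  (word-injective (trans (map-id (word ρ)) (sym (++-identityʳ (word ρ)))))
theorem3p3 σ@(partition (_ ∷ _) _) ρ _ _ connected = Avoidance.ccEquivalent σ ρ connected λ ()
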